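{- Let $\gamma$ be a weak composition of length $n$ and let $\lambda=\widetilde{\gamma}$. The map $\Theta$ is a bijection, with inverse $\Theta^{ -1}=\tilde\Theta$, between composition array patterns of shape $\gamma$ and Gelfand-Tsetlin patterns of shape $\widetilde{\gamma}=\lambda$. Moreover, the square with sides $\Theta\colon A\to B$, $\psi\colon A\to C$, $\varphi\colon B\to D$, $\theta\colon C\to D$ commutes, i.e. $\varphi\circ\Theta=\theta\circ\psi$, where - $A$ is the set of composition array patterns of shape $\gamma$, - $B$ is the set of Gelfand-Tsetlin patterns of shape $\widetilde{\gamma}=\lambda$, - $C$ is the set of column-strict composition tableaux of shape $\gamma^+$ with first column $\mathcal{F}(\gamma)$, - $D$ is the set of reverse column-strict Young tableaux of shape $\widetilde{\gamma}=\lambda$.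
   Context: For a weak composition $\gamma=(\gamma_1,\dots,\gamma_n)$ (a sequence of nonnegative integers): $\gamma^+$ is obtained by deleting the zero parts; $\widetilde\gamma$ is the partition obtained by placing the parts of $\gamma$ in weakly decreasing order; $\mathcal{F}(\gamma)=\{i\mid\gamma_i>0\}$. Diagrams have left-justified rows, row $i$ from the top having as many boxes as the $i$th part. Composition array pattern of shape $\gamma$: a triangular array $(x_{i,j})$, $1\le i\le n$, $1\le j\le n-i+1$, of nonnegative integers satisfying (1) $\gamma_i=x_{1,i}$; (2) $x_{i,j}\le x_{i-1,j+1}$; and (3) for all $1\le i\le n-1$ and all $0\le r<s\le n-i$, $$(x_{i+1,r}\ge x_{i+1,s}\text{ and }x_{i+1,r}\ge x_{i,s+1})\quad\text{or}\quad(x_{i+1,r}<x_{i+1,s}<x_{i,s+1}\text{ and }x_{i,r+1}<x_{i+1,s}),$$ where $x_{j,0}=0$ for all $j$. Gelfand-Tsetlin pattern of shape $\lambda$: a triangular array $(x_{i,j})$, same index set, of nonnegative integers with first row $\lambda$ and $x_{i,j}\ge x_{i+1,j}\ge x_{i,j+1}$ for all $1\le i\le n-1$, $1\le j\le n-i$. Column-strict composition tableau of shape $\alpha$, where $\alpha$ has $k$ parts (all positive) and largest part $m$: a filling $U$ of the diagram of $\alpha$ with positive integers such that (1) the first column strictly increases from top to bottom; (2) each row weakly decreases from left to right; (3) with $\hat U$ the $k\times m$ array obtained from $U$ by adding zeros at the ends of rows, for $1\le i_1<i_2\le k$ and $2\le j\le m$: if $\hat U(i_2,j)\ne0$ and $\hat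 U(i_2,j)\ge\hat U(i_1,j)$, then $\hat U(i_2,j)>\hat U(i_1,j-1)$. "First column $\mathcal F(\gamma)$" means that the set of entries of the first column is $\mathcal F(\gamma)$. Reverse column-strict Young tableau of shape $\lambda$: a filling of the diagram of $\lambda$ with positive integers whose rows weakly decrease from left to right and whose columns strictly decrease from top to bottom. The maps: - $\Theta$ sorts each row of a composition array pattern into weakly decreasing order. - $\tilde\Theta$ transforms a Gelfand-Tsetlin pattern into a new triangular array, row by row from row $n$ up to row $1$. Row $n$ is fixed. Inductively, the entries of row $i$ of the pattern are taken from least to greatest and each is placed in the unoccupied position $(i,k)$, $k>1$, as far to the right as possible such that the entry of the new array at position $(i+1,k-1)$ is weakly less than the entry being placed; if no such position with $k>1$ exists, the entry is placed in position $(i,1)$. - $\psi$: given a composition array pattern $(x_{i,j})$ of shape $\gamma$, for $i=n,n-1,\dots,1$ fill with the entry $i$ those boxes of the diagram of $(x_{i,1},\dots,x_{i,n-i+1})$ which are not in the diagram of $(x_{i+1,1},\dots,x_{i+1,n-i})$, the latter being placed in the lower left corner of the former (so its $j$th row sits in row $j+1$). This fills the diagram of $\gamma$; deleting empty rows gives a filling of shape $\gamma^+$. - $\varphi$: given a Gelfand-Tsetlin pattern $(x_{i,j})$ of shape $\lambda$, for each $i$ fill the boxes of the skew shape $(x_{i,1},\dots,x_{i,n-i+1})/(x_{i+1,1},\dots,x_{i+1,n-i})$ inside the diagram of $\lambda$ with the entry $i$. - $\theta$: the $i$th column of $\theta(U)$ is the $i$th column of $U$ sorted into strictly decreasing order from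 top to bottom.
   Formalization: Condition (3) of array patterns gets a third alternative, x_{i+1,r} < x_{i+1,s} = x_{i,s+1} (else none has shape (1,1)); the bijection is between array patterns of all shapes rearranging γ and Gelfand-Tsetlin patterns of shape λ (fixed γ=(1,0) fails: 1 versus 2). -}

module Defs where

open import Data.Fin.Base as Fin using (Fin; inject₁; toℕ)
open import Data.List.Base as List
  using (List; []; _∷_; _++_; applyUpTo; drop; filter; foldl; head; length;
         mapMaybe; replicate)
open import Data.List.Extrema.Nat using (max)
open import Data.List.Membership.Propositional using (_∈_)
import Data.List.Relation.Binary.Permutation.Propositional.Properties as Perm
open import Data.List.Relation.Unary.All using (All)
open import Data.List.Relation.Unary.Linked using (Linked)
open import Data.List.Sort.Base using (SortingAlgorithm)
import Data.List.Sort.InsertionSort as InsertionSort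
open import Data.Maybe.Base using (Maybe; just; nothing; fromMaybe)
open import Data.Nat.Base
open import Data.Nat.Properties using (_<?_; _≤?_; ≤-decTotalOrder)
open import Data.Product.Base using (_×_; ∃-syntax)
open import Data.Sum.Base using (_⊎_)
open import Data.Unit.Base using (⊤)
open import Data.Vec.Base as Vec using (Vec; []; _∷_; _∷ʳ_; lookup; toList)
open import Data.Vec.Properties using (length-toList)
open import Function.Base using (_∘_; _$_)
open import Level using (0ℓ)
open import Relation.Binary.Construct.Flip.EqAndOrd using (decTotalOrder)
open import Relation.Binary.PropositionalEquality using (_≡_; _≢_; trans)
open import Relation.Nullary.Decidable using (yes; no)
open import Relation.Unary using (Pred; _⊆_; _⊢_; _≐_)

module Decreasing = InsertionSort (decTotalOrder ≤-decTotalOrder)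

sort↓ : List ℕ → List ℕ
sort↓ = Decreasing.sort

infix 9 _~ _⁺

_~ : ∀ {n} → Vec ℕ n → Vec ℕ n
γ ~ = Vec.cast
  (trans (Perm.↭-length (sort-↭ (toList γ))) (length-toList γ))
  (Vec.fromList (sort↓ (toList γ)))
  where open SortingAlgorithm Decreasing.insertionSort using (sort-↭)

_⁺ : ∀ {n} → Vec ℕ n → List ℕ
γ ⁺ = filter (0 <?_) (toList γ)

𝓕 : ∀ {n} → Vec ℕ n → Pred ℕ 0ℓ
𝓕 {n} γ i = ∃[ k ] (i ≡ suc (toℕ {n} k) × lookup γ k > 0)

-- A triangular array of size n is its first row, of length n, followed by a
-- triangular array of size n ∸ 1; row i has length n ∸ i + 1.
data Triangle : ℕ → Set where
  []  : Triangle 0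
  _∷_ : ∀ {n} → Vec ℕ (suc n) → Triangle n → Triangle (suc n)

row₁ : ∀ {n} → Triangle n → Vec ℕ n
row₁ []      = []
row₁ (u ∷ _) = u

ConsecutiveRows : (∀ {m} → Vec ℕ (suc m) → Vec ℕ m → Set) →
                  ∀ {n} → Triangle n → Set
ConsecutiveRows R []      = ⊤
ConsecutiveRows R (u ∷ X) = R u (row₁ X) × ConsecutiveRows R X

-- For u = (x_{i,1}, …, x_{i,m+1}) and v = (x_{i+1,1}, …, x_{i+1,m}), and for
-- 0 ≤ r ≤ m, the numbers x_{i+1,r} (with x_{i+1,0} = 0) and x_{i,r+1} are the
-- r-th entries of 0 ∷ v and of u respectively.
module _ {m} (u : Vec ℕ (suc m)) (v : Vec ℕ m) where

  private
    below above : Fin (suc m) → ℕ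
    below = lookup (0 ∷ v)
    above = lookup u

  -- The last alternative, x_{i+1,r} < x_{i+1,s} = x_{i,s+1}, cannot be dropped:
  -- with the first two alone there would be no array of shape (1, 1), and the
  -- Gelfand-Tsetlin pattern with rows (1, 1), (1) would not be a sorted array.
  Triple : Fin (suc m) → Fin (suc m) → Set
  Triple r s =
      (below r ≥ below s × below r ≥ above s)
    ⊎ (below r < below s × below s < above s × above r < below s)
    ⊎ (below r < below s × below s ≡ above s)

  CAPRows : Set
  CAPRows = (∀ r → below r ≤ above r) × (∀ r s → r Fin.< s → Triple r s)

  GTRows : Set
  GTRows = ∀ j → lookup u (inject₁ j) ≥ lookup v j × lookup v j ≥ lookup u (Fin.suc j)

IsCAP : ∀ {n} → Vec ℕ n → Pred (Triangle n) 0ℓ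
IsCAP γ X = row₁ X ≡ γ × ConsecutiveRows CAPRows X

IsGT : ∀ {n} → Vec ℕ n → Pred (Triangle n) 0ℓ
IsGT μ Y = row₁ Y ≡ μ × ConsecutiveRows GTRows Y

-- Composition array patterns whose shape is any rearrangement of the parts of μ.
-- Sorting forgets the order of the parts, so this is the domain on which it is
-- bijective: one array of shape (1, 0) and one of shape (0, 1) correspond to the
-- two Gelfand-Tsetlin patterns of shape (1, 0).
IsCAPSortingTo : ∀ {n} → Vec ℕ n → Pred (Triangle n) 0ℓ
IsCAPSortingTo μ X = ∃[ γ ] (γ ~ ≡ μ × IsCAP γ X)

Θ : ∀ {n} → Triangle n → Triangle n
Θ []      = []
Θ (u ∷ X) = u ~ ∷ Θ X

-- Positions k > 1 of the current row, each above-right of an entry of the row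
-- below; the recursive call comes first because the rightmost position wins.
placeRight : ∀ {m} → ℕ → Vec ℕ m → Vec (Maybe ℕ) m → Maybe (Vec (Maybe ℕ) m)
placeRight e []      []      = nothing
placeRight e (b ∷ v) (o ∷ w) with placeRight e v w | o | b ≤? e
... | just w′ | _       | _     = just (o ∷ w′)
... | nothing | nothing | yes _ = just (just e ∷ w)
... | nothing | _       | _     = nothing

place : ∀ {m} → Vec ℕ m → Vec (Maybe ℕ) (suc m) → ℕ → Vec (Maybe ℕ) (suc m)
place v (o ∷ w) e with placeRight e v w
... | just w′ = o ∷ w′
... | nothing = just e ∷ w

-- On a Gelfand-Tsetlin pattern every position ends up occupied, so the default
-- value 0 is never used.
rearrange : ∀ {m} → Vec ℕ m → Vec ℕ (suc m) → Vec ℕ (suc m)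
rearrange {m} v u = Vec.map (fromMaybe 0) $
  foldl (place v) (Vec.replicate (suc m) nothing) (List.reverse (toList (u ~)))

Θ̃ : ∀ {n} → Triangle n → Triangle n
Θ̃ []      = []
Θ̃ (u ∷ Y) = rearrange (row₁ (Θ̃ Y)) u ∷ Θ̃ Y

-- Fillings of left-justified diagrams, as lists of rows from top to bottom.
-- Empty rows are always deleted, so the diagram of a partition μ with trailing
-- zeros is that of μ ⁺.
Filling : Set
Filling = List (List ℕ)

_at_ : List ℕ → ℕ → Maybe ℕ
row at j = head (drop j row)

-- Columns are numbered from 0, and column T j lists the entries of the boxes
-- actually present in that column.
column : Filling → ℕ → List ℕ
column T j = mapMaybe (_at j) T

columns : Filling → List (List ℕ)
columns T = applyUpTo (column T) (max 0 (List.map length T))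

-- The entries of the array obtained by padding the rows with zeros.
entry : (T : Filling) → Fin (length T) → ℕ → ℕ
entry T i j = fromMaybe 0 (List.lookup T i at j)

-- In `triples`, the nonzero hypothesis forces column suc j to lie within the
-- diagram.
record IsCompositionTableau (α : List ℕ) (U : Filling) : Set where
  field
    shape       : List.map length U ≡ α
    positive    : All (All (0 <_)) U
    firstColumn : Linked _<_ (column U 0)
    rows        : All (Linked _≥_) U
    triples     : ∀ i₁ i₂ j → i₁ Fin.< i₂ →
                  entry U i₂ (suc j) ≢ 0 →
                  entry U i₂ (suc j) ≥ entry U i₁ (suc j) →
                  entry U i₂ (suc j) > entry U i₁ j

IsCompositionTableauWithFirstColumn : List ℕ → Pred ℕ 0ℓ → Pred Filling 0ℓ
IsCompositionTableauWithFirstColumn α S U =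
  IsCompositionTableau α U × (_∈ column U 0) ≐ S

record IsReverseTableau (α : List ℕ) (T : Filling) : Set where
  field
    shape    : List.map length T ≡ α
    positive : All (All (0 <_)) T
    rows     : All (Linked _≥_) T
    cols     : ∀ j → Linked _>_ (column T j)

nonemptyRows : ∀ {n} → Vec (List ℕ) n → Filling
nonemptyRows = filter ((0 <?_) ∘ length) ∘ toList

extend : ℕ → List ℕ → ℕ → List ℕ
extend i row k = row ++ replicate (k ∸ length row) i

-- In both fillings i is the number attached to the first row of the triangle.
ψ-rows : ∀ {n} → ℕ → Triangle n → Vec (List ℕ) n
ψ-rows i []      = []
ψ-rows i (u ∷ X) = Vec.zipWith (extend i) ([] ∷ ψ-rows (suc i) X) u

φ-rows : ∀ {n} → ℕ → Triangle n → Vec (List ℕ) n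
φ-rows i []      = []
φ-rows i (u ∷ Y) = Vec.zipWith (extend i) (φ-rows (suc i) Y ∷ʳ []) u

ψ : ∀ {n} → Triangle n → Filling
ψ X = nonemptyRows (ψ-rows 1 X)

φ : ∀ {n} → Triangle n → Filling
φ Y = nonemptyRows (φ-rows 1 Y)

-- The outer `columns` turns the list of sorted columns back into rows.
θ : Filling → Filling
θ U = columns (List.map sort↓ (columns U))

record Inverses {X Y : Set} (A : Pred X 0ℓ) (B : Pred Y 0ℓ)
                (f : X → Y) (g : Y → X) : Set where
  field
    to       : A ⊆ f ⊢ B
    from     : B ⊆ g ⊢ A
    inverseˡ : ∀ {y} → B y → f (g y) ≡ y
    inverseʳ : ∀ {x} → A x → g (f x) ≡ x

record CommutingSquare {W X Y Z : Set}
                       (A : Pred W 0ℓ) (B : Pred X 0ℓ) (C : Pred Y 0ℓ) (D : Pred Z 0ℓ)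
                       (A→B : W → X) (A→C : W → Y) (B→D : X → Z) (C→D : Y → Z) : Set where
  field
    top      : A ⊆ A→B ⊢ B
    left     : A ⊆ A→C ⊢ C
    right    : B ⊆ B→D ⊢ D
    bottom   : C ⊆ C→D ⊢ D
    commutes : ∀ {x} → A x → B→D (A→B x) ≡ C→D (A→C x)

{-# OPTIONS --safe #-}

-- Write b = (0, x_{i+1,1}, x_{i+1,2}, …) and u = (x_{i,1}, x_{i,2}, …) for two
-- consecutive rows, and count for every c the parts exceeding c, i.e. the boxes
-- of column c, numbered from 0. Two weakly decreasing rows satisfy the Gelfand-Tsetlin inequalities
-- exactly when each of these counts grows by 0 or 1 from b to u. The triple
-- condition says that for r < s no column c has b_s ≤ c < u_s and
-- b_r ≤ c ≤ u_r; in particular at most one row gets a new box in column c, so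
-- sorting yields a Gelfand-Tsetlin pattern. Conversely, the greedy placement
-- ensures that u_s ≤ u_r whenever r < s and b_s ≤ u_r, so a violation of the
-- triple condition would give two new boxes in one column. It is also forced: in
-- a composition array pattern, the rightmost free position where the least
-- remaining entry fits already holds that value.
--
-- For the square, ψ and φ both add to column c as many entries i as the count of
-- c grows, so the columns of ψ X and φ (Θ X) are rearrangements of each other,
-- and those of φ (Θ X) strictly decrease.

module Submission where

open import Defs
open import Data.Fin.Base as Fin using (Fin; zero; suc; toℕ; inject₁)
open import Data.Fin.Properties as Fin using (toℕ-inject₁)
open import Data.List.Base as List
  using (List; []; _∷_; _++_; applyUpTo; drop; filter; foldl; head; length; map;
         mapMaybe; reverse)
open import Data.List.Extrema.Nat using (max; max≤v⁺; xs≤max)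
open import Data.List.Membership.Propositional using (_∈_; find)
open import Data.List.Membership.Propositional.Properties using (∈-lookup)
open import Data.List.Properties as List using (unfold-reverse)
open import Data.List.Relation.Binary.Permutation.Propositional
  using (_↭_; ↭-refl; ↭-sym; ↭-trans; ↭-prep; ↭-swap; ↭⇒↭ₛ)
open import Data.List.Relation.Binary.Permutation.Propositional.Properties as Perm
  using (↭-length; ↭-reverse; All-resp-↭; ∈-resp-↭; drop-∷)
import Data.List.Relation.Binary.Permutation.Setoid.Properties as PermSetoid
open import Data.List.Relation.Unary.All as All using (All; []; _∷_)
import Data.List.Relation.Unary.All.Properties as All
open import Data.List.Relation.Unary.AllPairs as AllPairs using (AllPairs; []; _∷_)
import Data.List.Relation.Unary.AllPairs.Properties as AllPairs
open import Data.List.Relation.Unary.Any using (here; there; index)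
open import Data.List.Relation.Unary.Any.Properties using (lookup-index)
open import Data.List.Relation.Unary.Linked using (Linked; [-]; _∷_)
open import Data.List.Relation.Unary.Linked.Properties
  using (Linked⇒AllPairs; AllPairs⇒Linked)
open import Data.List.Sort.Base using (SortingAlgorithm)
open import Data.Maybe.Base as Maybe using (Maybe; just; nothing; fromMaybe; maybe′)
open import Data.Maybe.Properties using (just-injective)
open import Data.Nat.Base
open import Data.Nat.ListAction using (sum)
open import Data.Nat.ListAction.Properties using (sum-↭)
open import Data.Nat.Properties
open import Data.Product.Base using (_×_; _,_; proj₁; proj₂; ∃-syntax)
open import Data.Sum.Base using (_⊎_; inj₁; inj₂)
open import Data.Unit.Base using (tt)
open import Data.Vec.Base as Vec using (Vec; []; _∷_; lookup; toList; replicate; _[_]≔_)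
open import Data.Vec.Membership.Propositional.Properties using (∈-toList⁺)
  renaming (∈-lookup to ∈-lookupᵛ)
open import Data.Vec.Properties as Vec
  using (toList-cast; toList∘fromList; toList-injective; cast-is-id;
         lookup∘update; lookup∘update′; lookup-map; lookup-replicate)
open import Function.Base using (_∘_; flip; id)
open import Relation.Binary.Definitions using (tri<; tri≈; tri>)
open import Relation.Binary.PropositionalEquality
open import Relation.Nullary.Decidable using (yes; no)
open import Relation.Nullary.Negation using (¬_; contradiction)
open import Relation.Unary using (_≐_)

private variable
  m n k : ℕ
  A : Set

-- The polymorphic version of _at_.
nth : List A → ℕ → Maybe A
nth xs j = head (drop j xs)

nth-[] : ∀ j → nth {A} [] j ≡ nothing
nth-[] zero    = refl
nth-[] (suc j) = refl

nth-ext : ∀ {xs ys : List A} → (∀ j → nth xs j ≡ nth ys j) → xs ≡ ys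
nth-ext {xs = []}     {[]}     eq = refl
nth-ext {xs = []}     {y ∷ ys} eq = contradiction (eq 0) λ ()
nth-ext {xs = x ∷ xs} {[]}     eq = contradiction (eq 0) λ ()
nth-ext {xs = x ∷ xs} {y ∷ ys} eq = cong₂ _∷_ (just-injective (eq 0)) (nth-ext (eq ∘ suc))

nth-≥ : ∀ (xs : List A) {j} → length xs ≤ j → nth xs j ≡ nothing
nth-≥ []       {j}     _   = nth-[] j
nth-≥ (x ∷ xs) {suc j} l≤j = nth-≥ xs (s≤s⁻¹ l≤j)

nth-< : ∀ (xs : List A) {j} → j < length xs → ∃[ a ] nth xs j ≡ just a
nth-< (x ∷ xs) {zero}  _   = x , refl
nth-< (x ∷ xs) {suc j} j<l = nth-< xs (s<s⁻¹ j<l)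

nth⇒< : ∀ (xs : List A) {j a} → nth xs j ≡ just a → j < length xs
nth⇒< xs {j} eq = ≰⇒> λ l≤j → contradiction (trans (sym eq) (nth-≥ xs l≤j)) λ ()

nth-map : ∀ {B : Set} (f : A → B) xs j → nth (map f xs) j ≡ Maybe.map f (nth xs j)
nth-map f []       zero    = refl
nth-map f []       (suc j) = refl
nth-map f (x ∷ xs) zero    = refl
nth-map f (x ∷ xs) (suc j) = nth-map f xs j

nth-applyUpTo : ∀ (f : ℕ → A) {n j} → j < n → nth (applyUpTo f n) j ≡ just (f j)
nth-applyUpTo f {suc n} {zero}  _   = refl
nth-applyUpTo f {suc n} {suc j} j<n = nth-applyUpTo (f ∘ suc) (s<s⁻¹ j<n)

nth-All : ∀ {P : A → Set} {xs} j {a} → All P xs → nth xs j ≡ just a → P a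
nth-All zero    (px ∷ _)  refl = px
nth-All (suc j) (_ ∷ pxs) eq   = nth-All j pxs eq
nth-All zero    []        ()
nth-All (suc j) []        ()

nth-++ˡ : ∀ (xs : List A) {ys j} → j < length xs → nth (xs ++ ys) j ≡ nth xs j
nth-++ˡ (x ∷ xs) {j = zero}  _   = refl
nth-++ˡ (x ∷ xs) {j = suc j} j<l = nth-++ˡ xs (s<s⁻¹ j<l)

nth-++ʳ : ∀ (xs : List A) {ys j} → length xs ≤ j → nth (xs ++ ys) j ≡ nth ys (j ∸ length xs)
nth-++ʳ []                   _   = refl
nth-++ʳ (x ∷ xs) {j = suc j} l≤j = nth-++ʳ xs (s≤s⁻¹ l≤j)

nth-replicate : ∀ {n j} {a : A} → j < n → nth (List.replicate n a) j ≡ just a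
nth-replicate {n = suc n} {zero}  _   = refl
nth-replicate {n = suc n} {suc j} j<n = nth-replicate (s<s⁻¹ j<n)

-- Counting parts and sorting

-- The indicator of `c < x`, written arithmetically so that its monotonicity in `x` and antitonicity
-- in `c` come from those of `_⊓_` and `_∸_`.
exceeds : ℕ → ℕ → ℕ
exceeds c x = 1 ⊓ (x ∸ c)

-- For a partition xs, the number of boxes in column c.
cnt : ℕ → List ℕ → ℕ
cnt c xs = sum (map (exceeds c) xs)

exceeds-> : ∀ {c x} → c < x → exceeds c x ≡ 1
exceeds-> = m≤n⇒m⊓n≡m ∘ m<n⇒0<n∸m

exceeds-≤ : ∀ {c x} → x ≤ c → exceeds c x ≡ 0
exceeds-≤ = cong (1 ⊓_) ∘ m≤n⇒m∸n≡0

exceeds-mono : ∀ c {x y} → x ≤ y → exceeds c x ≤ exceeds c y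
exceeds-mono c = ⊓-monoʳ-≤ 1 ∘ ∸-monoˡ-≤ c

cnt-mono : ∀ c (b u : Vec ℕ k) → (∀ r → lookup b r ≤ lookup u r) → cnt c (toList b) ≤ cnt c (toList u)
cnt-mono c []      []      b≤u = z≤n
cnt-mono c (x ∷ b) (y ∷ u) b≤u = +-mono-≤ (exceeds-mono c (b≤u zero)) (cnt-mono c b u (b≤u ∘ suc))

cnt-↭ : ∀ c {xs ys} → xs ↭ ys → cnt c xs ≡ cnt c ys
cnt-↭ c = sum-↭ ∘ Perm.map⁺ (exceeds c)

cnt≤length : ∀ c xs → cnt c xs ≤ length xs
cnt≤length c []       = z≤n
cnt≤length c (x ∷ xs) = +-mono-≤ (m⊓n≤m 1 (x ∸ c)) (cnt≤length c xs)

cnt-none : ∀ {c xs} → All (_≤ c) xs → cnt c xs ≡ 0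
cnt-none []         = refl
cnt-none (px ∷ pxs) = cong₂ _+_ (exceeds-≤ px) (cnt-none pxs)

cnt-0∷ : ∀ c xs → cnt c (0 ∷ xs) ≡ cnt c xs
cnt-0∷ c xs = cong (_+ cnt c xs) (exceeds-≤ {c} z≤n)

cnt-all : ∀ {c xs} → All (c <_) xs → cnt c xs ≡ length xs
cnt-all []         = refl
cnt-all (px ∷ pxs) = cong₂ _+_ (exceeds-> px) (cnt-all pxs)

cnt-zero⇒All : ∀ {c} xs → cnt c xs ≡ 0 → All (_≤ c) xs
cnt-zero⇒All         []       _  = []
cnt-zero⇒All {c} (x ∷ xs) eq with <-≤-connex c x
... | inj₂ x≤c = x≤c ∷ cnt-zero⇒All xs (m+n≡0⇒n≡0 (exceeds c x) eq)
... | inj₁ c<x = contradiction (trans (sym (exceeds-> c<x)) (m+n≡0⇒m≡0 (exceeds c x) eq)) λ ()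

cnt-antimono : ∀ {c d} xs → c ≤ d → cnt d xs ≤ cnt c xs
cnt-antimono []       c≤d = z≤n
cnt-antimono (x ∷ xs) c≤d = +-mono-≤ (⊓-monoʳ-≤ 1 (∸-monoʳ-≤ x c≤d)) (cnt-antimono xs c≤d)

-- Weakly decreasing lists and their counts.

Descending : List ℕ → Set
Descending = AllPairs _≥_

≥-trans : ∀ {x y z} → x ≥ y → y ≥ z → x ≥ z
≥-trans = flip ≤-trans

sort↓-↭ : ∀ xs → sort↓ xs ↭ xs
sort↓-↭ = SortingAlgorithm.sort-↭ Decreasing.insertionSort

sort↓-descending : ∀ xs → Descending (sort↓ xs)
sort↓-descending xs = Linked⇒AllPairs ≥-trans (SortingAlgorithm.sort-↗ Decreasing.insertionSort xs)

descending-head : ∀ {c x xs} → Descending (x ∷ xs) → x ≤ c → All (_≤ c) (x ∷ xs)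
descending-head (x≥xs ∷ _) x≤c = x≤c ∷ All.map (flip ≤-trans x≤c) x≥xs

-- In a descending list the entries exceeding `c` form an initial segment, whose length is
-- `cnt c xs`. This and the converse `<cnt⇒at` translate between entries and counts.
at⇒<cnt : ∀ {xs} → Descending xs → ∀ j {a c} → xs at j ≡ just a → c < a → j < cnt c xs
at⇒<cnt {[]}     []        j       eq   c<a = contradiction (trans (sym (nth-[] j)) eq) λ ()
at⇒<cnt {x ∷ xs} (_ ∷ _)   zero    refl c<a = ≤-trans (≤-reflexive (sym (exceeds-> c<a))) (m≤m+n _ _)
at⇒<cnt {x ∷ xs} (x≥ ∷ d) (suc j) {a} {c} eq   c<a with <-≤-connex c x
... | inj₁ c<x rewrite exceeds-> c<x = s<s (at⇒<cnt d j eq c<a)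
... | inj₂ x≤c = contradiction
  (≤-trans (at⇒<cnt d j eq c<a) (≤-reflexive (cnt-none (All.tail (descending-head (x≥ ∷ d) x≤c))))) λ ()

<cnt⇒at : ∀ {xs} → Descending xs → ∀ j {a c} → xs at j ≡ just a → j < cnt c xs → c < a
<cnt⇒at {x ∷ xs} d j {a} {c} eq j<cnt with <-≤-connex c x
<cnt⇒at {x ∷ xs} d        zero    refl j<cnt | inj₁ c<x = c<x
<cnt⇒at {x ∷ xs} (_ ∷ d) (suc j) eq   j<cnt | inj₁ c<x rewrite exceeds-> c<x = <cnt⇒at d j eq (s<s⁻¹ j<cnt)
<cnt⇒at {x ∷ xs} d        j       eq   j<cnt | inj₂ x≤c =
  contradiction (≤-trans j<cnt (≤-reflexive (cnt-none (descending-head d x≤c)))) λ ()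

-- At threshold `y` the second list has count 0, so the first list has no entry above `y`.
descending-heads : ∀ {x y xs ys} → Descending (x ∷ xs) → Descending (y ∷ ys) →
                   cnt y (x ∷ xs) ≡ cnt y (y ∷ ys) → x ≤ y
descending-heads d e eq = ≮⇒≥ λ y<x → contradiction
  (≤-trans (at⇒<cnt d 0 refl y<x) (≤-reflexive (trans eq (cnt-none (descending-head e ≤-refl))))) λ ()

-- A partition is determined by its column lengths, once the number of parts is fixed, since zero
-- parts do not show in the counts. Equal heads contribute equally and cancel.
descending-unique : ∀ {xs ys} → Descending xs → Descending ys → length xs ≡ length ys →
                    (∀ c → cnt c xs ≡ cnt c ys) → xs ≡ ys
descending-unique {[]}     {[]}     _ _ _ _ = refl
descending-unique {x ∷ xs} {y ∷ ys} d e l same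
  with refl ← ≤-antisym (descending-heads d e (same y)) (descending-heads e d (sym (same x))) =
  cong (x ∷_) (descending-unique (AllPairs.tail d) (AllPairs.tail e) (suc-injective l)
    λ c → +-cancelˡ-≡ (exceeds c x) _ _ (same c))

descending-↭⇒≡ : ∀ {xs ys} → Descending xs → Descending ys → xs ↭ ys → xs ≡ ys
descending-↭⇒≡ d e p = descending-unique d e (↭-length p) λ c → cnt-↭ c p

toList-~ : (γ : Vec ℕ n) → toList (γ ~) ≡ sort↓ (toList γ)
toList-~ γ = trans (toList-cast _ (Vec.fromList (sort↓ (toList γ)))) (toList∘fromList _)

~-↭ : (γ : Vec ℕ n) → toList (γ ~) ↭ toList γ
~-↭ γ rewrite toList-~ γ = sort↓-↭ (toList γ)

~-descending : (γ : Vec ℕ n) → Descending (toList (γ ~))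
~-descending γ rewrite toList-~ γ = sort↓-descending (toList γ)

~-unique : (γ μ : Vec ℕ n) → toList γ ↭ toList μ → Descending (toList μ) → γ ~ ≡ μ
~-unique γ μ p d = trans (sym (cast-is-id refl (γ ~))) (toList-injective refl (γ ~) μ
  (descending-↭⇒≡ (~-descending γ) d (↭-trans (~-↭ γ) p)))

toList-at : (u : Vec ℕ n) (j : Fin n) → toList u at toℕ j ≡ just (lookup u j)
toList-at (x ∷ u) zero    = refl
toList-at (x ∷ u) (suc j) = toList-at u j

-- For partitions, the skew shape u / v is a horizontal strip.
Strip : Vec ℕ m → Vec ℕ n → Set
Strip u v = ∀ c → cnt c (toList v) ≤ cnt c (toList u) × cnt c (toList u) ≤ suc (cnt c (toList v))

-- The lower bound compares `v` entrywise with `u` without its last entry. The upper bound compares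
-- `u` without its first entry with `v`; the first entry counts at most 1.
GTRows⇒Strip : (u : Vec ℕ (suc m)) (v : Vec ℕ m) → GTRows u v → Strip u v
GTRows⇒Strip u v gt c = lower u v (proj₁ ∘ gt) , upper u v (proj₂ ∘ gt)
  where
  lower : ∀ {m} (u : Vec ℕ (suc m)) (v : Vec ℕ m) → (∀ j → lookup u (inject₁ j) ≥ lookup v j) →
          cnt c (toList v) ≤ cnt c (toList u)
  lower u       []      ≥v = z≤n
  lower (x ∷ u) (y ∷ v) ≥v = +-mono-≤ (exceeds-mono c (≥v zero)) (lower u v (≥v ∘ suc))
  upper : ∀ {m} (u : Vec ℕ (suc m)) (v : Vec ℕ m) → (∀ j → lookup v j ≥ lookup u (suc j)) →
          cnt c (toList u) ≤ suc (cnt c (toList v))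
  upper (x ∷ u) v ≥u = +-mono-≤ (m⊓n≤m 1 (x ∸ c)) (cnt-mono c u v ≥u)

-- A violated inequality shows at the threshold equal to its smaller side: the larger side is
-- counted there, and the bounds on the counts then make the smaller side exceed itself.
Strip⇒GTRows : (u : Vec ℕ (suc m)) (v : Vec ℕ m) → Descending (toList u) → Descending (toList v) →
               Strip u v → GTRows u v
Strip⇒GTRows u v du dv strip j = ≮⇒≥ lower , ≮⇒≥ upper
  where
  lower : ¬ lookup u (inject₁ j) < lookup v j
  lower u<v = <-irrefl refl (<cnt⇒at du (toℕ (inject₁ j)) (toList-at u (inject₁ j))
    (subst (_< cnt (lookup u (inject₁ j)) (toList u)) (sym (toℕ-inject₁ j))
      (<-≤-trans (at⇒<cnt dv (toℕ j) (toList-at v j) u<v) (proj₁ (strip (lookup u (inject₁ j)))))))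
  upper : ¬ lookup v j < lookup u (suc j)
  upper v<u = <-irrefl refl (<cnt⇒at dv (toℕ j) (toList-at v j)
    (s<s⁻¹ (<-≤-trans (at⇒<cnt du (suc (toℕ j)) (toList-at u (suc j)) v<u) (proj₂ (strip (lookup v j))))))

-- Consecutive entries of `u` have an entry of `v` between them.
GTRows⇒descending : (u : Vec ℕ (suc m)) (v : Vec ℕ m) → GTRows u v → Descending (toList u)
GTRows⇒descending u v gt = Linked⇒AllPairs ≥-trans (linked u v gt)
  where
  linked : ∀ {m} (u : Vec ℕ (suc m)) (v : Vec ℕ m) → GTRows u v → Linked _≥_ (toList u)
  linked (x ∷ [])    []      gt = [-]
  linked (x ∷ y ∷ u) (z ∷ v) gt = ≤-trans (proj₂ (gt zero)) (proj₁ (gt zero)) ∷ linked (y ∷ u) v (gt ∘ suc)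

-- Boxes added in column `c` when rows grow from lengths `b` to lengths `u`.

Added : ℕ → ℕ → ℕ → Set
Added c b u = b ≤ c × c < u

module _ (c : ℕ) where

  exceeds-unless-Added : ∀ {b u} → ¬ Added c b u → exceeds c u ≤ exceeds c b
  exceeds-unless-Added {b} {u} ¬new with <-≤-connex c u | <-≤-connex c b
  ... | inj₂ u≤c | _        rewrite exceeds-≤ u≤c = z≤n
  ... | inj₁ c<u | inj₁ c<b rewrite exceeds-> c<u | exceeds-> c<b = ≤-refl
  ... | inj₁ c<u | inj₂ b≤c = contradiction (b≤c , c<u) ¬new

  none-Added : (b u : Vec ℕ k) → (∀ r → ¬ Added c (lookup b r) (lookup u r)) →
               cnt c (toList u) ≤ cnt c (toList b)
  none-Added []      []      none = z≤n
  none-Added (x ∷ b) (y ∷ u) none = +-mono-≤ (exceeds-unless-Added (none zero)) (none-Added b u (none ∘ suc))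

  -- The first row with a new box contributes 1 and puts all later rows under `none-Added`; the rows
  -- before it do not raise the count.
  ≤one-Added : (b u : Vec ℕ k) →
               (∀ r s → r Fin.< s → Added c (lookup b r) (lookup u r) → ¬ Added c (lookup b s) (lookup u s)) →
               cnt c (toList u) ≤ suc (cnt c (toList b))
  ≤one-Added []      []      one = z≤n
  ≤one-Added (x ∷ b) (y ∷ u) one with <-≤-connex c y | <-≤-connex c x
  ... | inj₁ c<y | inj₂ x≤c rewrite exceeds-> c<y | exceeds-≤ x≤c =
    s≤s (none-Added b u λ r → one zero (suc r) z<s (x≤c , c<y))
  ... | inj₂ y≤c | _        rewrite exceeds-≤ y≤c =
    ≤-trans (≤one-Added b u λ r s r<s → one (suc r) (suc s) (s<s r<s)) (s≤s (m≤n+m _ _))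
  ... | inj₁ c<y | inj₁ c<x rewrite exceeds-> c<y | exceeds-> c<x =
    s≤s (≤one-Added b u λ r s r<s → one (suc r) (suc s) (s<s r<s))

  one-Added : (b u : Vec ℕ k) → (∀ r → lookup b r ≤ lookup u r) →
              ∀ r → Added c (lookup b r) (lookup u r) → cnt c (toList b) < cnt c (toList u)
  one-Added (x ∷ b) (y ∷ u) b≤u zero    (x≤c , c<y) rewrite exceeds-≤ x≤c | exceeds-> c<y =
    s≤s (cnt-mono c b u (b≤u ∘ suc))
  one-Added (x ∷ b) (y ∷ u) b≤u (suc r) new =
    +-mono-≤-< (exceeds-mono c (b≤u zero)) (one-Added b u (b≤u ∘ suc) r new)

  -- No row shrinks, so the two rows with a new box each raise the count by 1 and no other row
  -- lowers it.
  two-Added : (b u : Vec ℕ k) → (∀ r → lookup b r ≤ lookup u r) →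
              ∀ r s → r Fin.< s → Added c (lookup b r) (lookup u r) → Added c (lookup b s) (lookup u s) →
              suc (cnt c (toList b)) < cnt c (toList u)
  two-Added (x ∷ b) (y ∷ u) b≤u zero    (suc s) _   (x≤c , c<y) new rewrite exceeds-≤ x≤c | exceeds-> c<y =
    s<s (one-Added b u (b≤u ∘ suc) s new)
  two-Added (x ∷ b) (y ∷ u) b≤u (suc r) (suc s) r<s new new′ =
    ≤-trans (≤-reflexive (cong suc (sym (+-suc _ _))))
      (+-mono-≤-< (exceeds-mono c (b≤u zero)) (two-Added b u (b≤u ∘ suc) r s (s<s⁻¹ r<s) new new′))

-- The triple condition as disjointness of ranges of columns.

module _ (u : Vec ℕ (suc m)) (v : Vec ℕ m) where

  -- Each alternative separates the ranges: u_s is at most b_r, or u_r is below b_s, or row `s` gets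
  -- no new box. The range of `r` is closed on the right, and the later uses rely on this endpoint.
  Triple⇒disjoint : ∀ r s → Triple u v r s →
    ∀ c → Added c (lookup (0 ∷ v) s) (lookup u s) → lookup (0 ∷ v) r ≤ c → ¬ c ≤ lookup u r
  Triple⇒disjoint r s (inj₁ (_ , us≤br)) c (bs≤c , c<us) br≤c c≤ur =
    <-irrefl refl (<-≤-trans c<us (≤-trans us≤br br≤c))
  Triple⇒disjoint r s (inj₂ (inj₁ (_ , _ , ur<bs))) c (bs≤c , c<us) br≤c c≤ur =
    <-irrefl refl (≤-<-trans c≤ur (<-≤-trans ur<bs bs≤c))
  Triple⇒disjoint r s (inj₂ (inj₂ (_ , bs≡us))) c (bs≤c , c<us) br≤c c≤ur =
    <-irrefl refl (<-≤-trans c<us (≤-trans (≤-reflexive (sym bs≡us)) bs≤c))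

  -- If row `s` does not grow, comparing b_r with b_s selects the first or the third alternative.
  -- Otherwise the relative position of the two ranges selects the first or the second.
  disjoint⇒Triple : (∀ r → lookup (0 ∷ v) r ≤ lookup u r) → ∀ r s →
    (∀ c → Added c (lookup (0 ∷ v) s) (lookup u s) → lookup (0 ∷ v) r ≤ c → ¬ c ≤ lookup u r) → Triple u v r s
  disjoint⇒Triple b≤u r s disj with m≤n⇒m<n∨m≡n (b≤u s)
  ... | inj₂ bs≡us with <-≤-connex (lookup (0 ∷ v) r) (lookup (0 ∷ v) s)
  ...   | inj₁ br<bs = inj₂ (inj₂ (br<bs , bs≡us))
  ...   | inj₂ bs≤br = inj₁ (bs≤br , ≤-trans (≤-reflexive (sym bs≡us)) bs≤br)
  disjoint⇒Triple b≤u r s disj | inj₁ bs<us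
    with <-≤-connex (lookup (0 ∷ v) r) (lookup u s) | <-≤-connex (lookup u r) (lookup (0 ∷ v) s)
  ...   | inj₂ us≤br | _ = inj₁ (≤-trans (<⇒≤ bs<us) us≤br , us≤br)
  ...   | inj₁ br<us | inj₁ ur<bs = inj₂ (inj₁ (≤-<-trans (b≤u r) ur<bs , bs<us , ur<bs))
  -- The ranges overlap: the larger of their left ends lies in both.
  ...   | inj₁ br<us | inj₂ bs≤ur = contradiction (⊔-lub (b≤u r) bs≤ur)
    (disj (lookup (0 ∷ v) r ⊔ lookup (0 ∷ v) s) (m≤n⊔m _ _ , ⊔-lub br<us bs<us) (m≤m⊔n _ _))

CAPRows⇒Strip : (u : Vec ℕ (suc m)) (v : Vec ℕ m) → CAPRows u v → Strip u v
-- Putting 0 in front of `v` aligns it with `u` and changes no count.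
CAPRows⇒Strip u v (b≤u , triple) c rewrite sym (cnt-0∷ c (toList v)) =
  cnt-mono c (0 ∷ v) u b≤u ,
  ≤one-Added c (0 ∷ v) u λ r s r<s (br≤c , c<ur) new →
    Triple⇒disjoint u v r s (triple r s r<s) c new br≤c (<⇒≤ c<ur)

Strip-~ : (u : Vec ℕ m) (v : Vec ℕ n) → Strip u v → Strip (u ~) (v ~)
Strip-~ u v strip c rewrite cnt-↭ c (~-↭ u) | cnt-↭ c (~-↭ v) = strip c

CAPRows⇒GTRows : (u : Vec ℕ (suc m)) (v : Vec ℕ m) → CAPRows u v → GTRows (u ~) (v ~)
CAPRows⇒GTRows u v cap =
  Strip⇒GTRows (u ~) (v ~) (~-descending u) (~-descending v) (Strip-~ u v (CAPRows⇒Strip u v cap))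

-- The greedy placement

AllPairs-reverse : ∀ {R : A → A → Set} {xs} → AllPairs R xs → AllPairs (flip R) (reverse xs)
AllPairs-reverse []                              = []
AllPairs-reverse {R = R} {x ∷ xs} (Rx ∷ Rxs) rewrite unfold-reverse x xs =
  AllPairs.++⁺ (AllPairs-reverse Rxs) ([] ∷ []) (All-resp-↭ (↭-sym (↭-reverse xs)) (All.map (_∷ []) Rx))

-- Taken of the target row `u`, these are the values still to be placed; taken of `0 ∷ v`, they are
-- the lower bounds at the vacant positions.
free : Vec ℕ k → Vec (Maybe ℕ) k → List ℕ
free []       []            = []
free (x ∷ xs) (nothing ∷ o) = x ∷ free xs o
free (x ∷ xs) (just _ ∷ o)  = free xs o

occupied : Vec (Maybe ℕ) k → List ℕ
occupied = List.catMaybes ∘ toList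

free⁺ : (xs : Vec ℕ k) (o : Vec (Maybe ℕ) k) → ∀ r → lookup o r ≡ nothing → lookup xs r ∈ free xs o
free⁺ (x ∷ xs) (nothing ∷ o) zero    eq = here refl
free⁺ (x ∷ xs) (nothing ∷ o) (suc r) eq = there (free⁺ xs o r eq)
free⁺ (x ∷ xs) (just _ ∷ o)  (suc r) eq = free⁺ xs o r eq

free⁻ : ∀ (xs : Vec ℕ k) (o : Vec (Maybe ℕ) k) {y} → y ∈ free xs o →
        ∃[ r ] lookup o r ≡ nothing × y ≡ lookup xs r
free⁻ []       []            ()
free⁻ (x ∷ xs) (nothing ∷ o) (here y≡x) = zero , refl , y≡x
free⁻ (x ∷ xs) (nothing ∷ o) (there y∈) with r , or , eq ← free⁻ xs o y∈ = suc r , or , eq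
free⁻ (x ∷ xs) (just _ ∷ o)  y∈         with r , or , eq ← free⁻ xs o y∈ = suc r , or , eq

free-update : ∀ (xs : Vec ℕ k) (o : Vec (Maybe ℕ) k) r {e} → lookup o r ≡ nothing →
              free xs o ↭ lookup xs r ∷ free xs (o [ r ]≔ just e)
free-update (x ∷ xs) (nothing ∷ o) zero    eq = ↭-refl
free-update (x ∷ xs) (nothing ∷ o) (suc r) eq = ↭-trans (↭-prep x (free-update xs o r eq)) (↭-swap x _ ↭-refl)
free-update (x ∷ xs) (just _ ∷ o)  (suc r) eq = free-update xs o r eq

free-vacant : (xs : Vec ℕ k) → free xs (replicate k nothing) ≡ toList xs
free-vacant []       = refl
free-vacant (x ∷ xs) = cong (x ∷_) (free-vacant xs)

occupied-update : ∀ (o : Vec (Maybe ℕ) k) r {e} → lookup o r ≡ nothing →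
                  occupied (o [ r ]≔ just e) ↭ e ∷ occupied o
occupied-update (nothing ∷ o) zero    eq = ↭-refl
occupied-update (nothing ∷ o) (suc r) eq = occupied-update o r eq
occupied-update (just x ∷ o)  (suc r) eq = ↭-trans (↭-prep x (occupied-update o r eq)) (↭-swap x _ ↭-refl)

occupied-vacant : ∀ k → occupied (replicate k nothing) ≡ []
occupied-vacant zero    = refl
occupied-vacant (suc k) = occupied-vacant k

values : Vec (Maybe ℕ) k → Vec ℕ k
values = Vec.map (fromMaybe 0)

occupied-full : (o : Vec (Maybe ℕ) k) → (∀ r → lookup o r ≢ nothing) → occupied o ≡ toList (values o)
occupied-full []            full = refl
occupied-full (just x ∷ o)  full = cong (x ∷_) (occupied-full o (full ∘ suc))
occupied-full (nothing ∷ o) full = contradiction refl (full zero)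

just-or-nothing : (x : Maybe ℕ) → x ≡ nothing ⊎ ∃[ y ] x ≡ just y
just-or-nothing nothing  = inj₁ refl
just-or-nothing (just y) = inj₂ (y , refl)

-- The specification of one greedy step, which frees the later arguments from the recursion of
-- `placeRight`.
record Placement (e : ℕ) (b : Vec ℕ k) (o o′ : Vec (Maybe ℕ) k) : Set where
  field
    pos       : Fin k
    vacant    : lookup o pos ≡ nothing
    fits      : lookup b pos ≤ e
    rightmost : ∀ s → pos Fin.< s → lookup b s ≤ e → lookup o s ≢ nothing
    result    : o′ ≡ o [ pos ]≔ just e

data Outcome (e : ℕ) (b : Vec ℕ k) (o : Vec (Maybe ℕ) k) : Maybe (Vec (Maybe ℕ) k) → Set where
  placed : ∀ {o′} → Placement e b o o′ → Outcome e b o (just o′)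
  unplaced : (∀ s → lookup b s ≤ e → lookup o s ≢ nothing) → Outcome e b o nothing

Placement-∷ : ∀ {e x y} {b : Vec ℕ k} {o o′} → Placement e b o o′ → Placement e (x ∷ b) (y ∷ o) (y ∷ o′)
Placement-∷ p = record
  { pos = suc pos ; vacant = vacant ; fits = fits
  ; rightmost = λ { (suc s) pos<s → rightmost s (s<s⁻¹ pos<s) } ; result = cong (_ ∷_) result }
  where open Placement p

Placement-here : ∀ {e x} {b : Vec ℕ k} {o} → x ≤ e → (∀ s → lookup b s ≤ e → lookup o s ≢ nothing) →
                 Placement e (x ∷ b) (nothing ∷ o) (just e ∷ o)
Placement-here x≤e full = record
  { pos = zero ; vacant = refl ; fits = x≤e ; rightmost = λ { (suc s) _ → full s } ; result = refl }

placeRight-outcome : ∀ e (v : Vec ℕ m) w → Outcome e v w (placeRight e v w)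
placeRight-outcome e []      []            = unplaced λ ()
placeRight-outcome e (b ∷ v) (just x ∷ w)  with placeRight e v w | placeRight-outcome e v w
... | just _  | placed p = placed (Placement-∷ p)
... | nothing | unplaced f   = unplaced λ { zero _ () ; (suc s) → f s }
placeRight-outcome e (b ∷ v) (nothing ∷ w) with placeRight e v w | placeRight-outcome e v w | b ≤? e
... | just _  | placed p | _       = placed (Placement-∷ p)
... | nothing | unplaced f   | yes b≤e = placed (Placement-here b≤e f)
... | nothing | unplaced f   | no b≰e  = unplaced λ { zero b≤e → contradiction b≤e b≰e ; (suc s) → f s }

-- `place` falls back on position 0 without looking at its content. The vacant fitting position `r`
-- guarantees that nothing is overwritten: if no other position is found, `r` is position 0 itself,
-- where the bound is 0.
place-placement : ∀ e (v : Vec ℕ m) o r → lookup (0 ∷ v) r ≤ e → lookup o r ≡ nothing →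
                  Placement e (0 ∷ v) o (place v o e)
place-placement e v (x ∷ w) r b≤e or with placeRight e v w | placeRight-outcome e v w
place-placement e v (x ∷ w)       r       b≤e or | just _  | placed p = Placement-∷ p
place-placement e v (nothing ∷ w) r       b≤e or | nothing | unplaced f   = Placement-here z≤n f
place-placement e v (just _ ∷ w)  (suc r) b≤e or | nothing | unplaced f   = contradiction or (f r b≤e)

values-agree : (o : Vec (Maybe ℕ) k) (u : Vec ℕ k) → (∀ r → lookup o r ≢ nothing) →
               (∀ r {x} → lookup o r ≡ just x → x ≡ lookup u r) → values o ≡ u
values-agree []            []      _     _  = refl
values-agree (just x ∷ o)  (y ∷ u) full eq = cong₂ _∷_ (eq zero refl) (values-agree o u (full ∘ suc) (eq ∘ suc))
values-agree (nothing ∷ o) (y ∷ u) full eq = contradiction refl (full zero)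

module _ {e} {b : Vec ℕ k} {o o′} (p : Placement e b o o′) where
  open Placement p

  at-pos : lookup o′ pos ≡ just e
  at-pos rewrite result = lookup∘update pos o (just e)

  elsewhere : ∀ {r} → r ≢ pos → lookup o′ r ≡ lookup o r
  elsewhere r≢pos rewrite result = lookup∘update′ r≢pos o (just e)

  placement-entry : ∀ r {x} → lookup o′ r ≡ just x → (r ≡ pos × x ≡ e) ⊎ (r ≢ pos × lookup o r ≡ just x)
  placement-entry r eq with r Fin.≟ pos
  ... | yes refl = inj₁ (refl , sym (just-injective (trans (sym at-pos) eq)))
  ... | no r≢pos = inj₂ (r≢pos , trans (sym (elsewhere r≢pos)) eq)

  free-placement : (xs : Vec ℕ k) → free xs o ↭ lookup xs pos ∷ free xs o′
  free-placement xs rewrite result = free-update xs o pos vacant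

  occupied-placement : occupied o′ ↭ e ∷ occupied o
  occupied-placement rewrite result = occupied-update o pos vacant

no-vacancy : ∀ (xs : Vec ℕ k) o → [] ↭ free xs o → ∀ r → lookup o r ≢ nothing
no-vacancy xs o p r eq = contradiction (∈-resp-↭ (↭-sym p) (free⁺ xs o r eq)) λ ()

-- Greedy placement recovers the rows of a composition array pattern.

ascending : Vec ℕ k → List ℕ
ascending u = reverse (toList (u ~))

ascending-sorted : (u : Vec ℕ k) → AllPairs _≤_ (ascending u)
ascending-sorted u = AllPairs-reverse (~-descending u)

ascending-↭ : (u : Vec ℕ k) → ascending u ↭ toList u
ascending-↭ u = ↭-trans (↭-reverse (toList (u ~))) (~-↭ u)

module _ (u : Vec ℕ (suc m)) (v : Vec ℕ m) (cap : CAPRows u v) where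

  private
    b≤u = proj₁ cap
    triple = proj₂ cap

  module _ {e es o} (asc : AllPairs _≤_ (e ∷ es)) (rem : e ∷ es ↭ free u o) where

    vacant-value : ∃[ p ] lookup o p ≡ nothing × e ≡ lookup u p
    vacant-value = free⁻ u o (∈-resp-↭ rem (here refl))

    e≤vacant : ∀ r → lookup o r ≡ nothing → e ≤ lookup u r
    e≤vacant r or = All.lookup (≤-refl ∷ AllPairs.head asc) (∈-resp-↭ (↭-sym rem) (free⁺ u o r or))

    private
      p   = proj₁ vacant-value
      op  = proj₁ (proj₂ vacant-value)
      e≡  = proj₂ (proj₂ vacant-value)
      b≤e = ≤-trans (b≤u p) (≤-reflexive (sym e≡))

    placement : Placement e (0 ∷ v) o (place v o e)
    placement = place-placement e v o p b≤e op

    open Placement placement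

    -- The least remaining value `e` belongs to some vacant position `p`, where it fits; hence `pos`
    -- is not to the left of `p`. If it is to the right, its value is at least `e` by minimality and
    -- at most `e` by the triple condition.
    placed-value : lookup u pos ≡ e
    placed-value with Fin.<-cmp p pos
    ... | tri≈ _ p≡pos _ = trans (cong (lookup u) (sym p≡pos)) (sym e≡)
    ... | tri> _ _ pos<p = contradiction op (rightmost p pos<p b≤e)
    ... | tri< p<pos _ _ = ≤-antisym
      -- Column `e` is the right endpoint u_p of the range of `p`.
      (≮⇒≥ λ e<u → Triple⇒disjoint u v p pos (triple p pos p<pos) e (fits , e<u) b≤e (≤-reflexive e≡))
      (e≤vacant pos vacant)

    remaining : es ↭ free u (place v o e)
    remaining = drop-∷ (subst (λ x → e ∷ es ↭ x ∷ free u (place v o e)) placed-value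
      (↭-trans rem (free-placement placement u)))

    placed-agrees : (∀ r {x} → lookup o r ≡ just x → x ≡ lookup u r) →
                    ∀ r {x} → lookup (place v o e) r ≡ just x → x ≡ lookup u r
    placed-agrees agrees r eq with placement-entry placement r eq
    ... | inj₁ (refl , refl) = sym placed-value
    ... | inj₂ (_ , eq′)     = agrees r eq′

  -- The invariant of the fold: the entries left are the values of `u` at the vacant positions, and
  -- each occupied position already holds its value in `u`.
  refill : ∀ es o → AllPairs _≤_ es → es ↭ free u o →
           (∀ r {x} → lookup o r ≡ just x → x ≡ lookup u r) →
           values (foldl (place v) o es) ≡ u
  refill []       o asc rem agrees = values-agree o u (no-vacancy u o rem) agrees
  refill (e ∷ es) o asc rem agrees =
    refill es (place v o e) (AllPairs.tail asc) (remaining asc rem) (placed-agrees asc rem agrees)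

  rearrange-unique : ∀ w → toList w ↭ toList u → rearrange v w ≡ u
  rearrange-unique w w↭u = refill (ascending w) (replicate _ nothing) (ascending-sorted w)
    (subst (ascending w ↭_) (sym (free-vacant u)) (↭-trans (ascending-↭ w) w↭u))
    λ r eq → contradiction (trans (sym (lookup-replicate r nothing)) eq) λ ()

-- Greedy placement produces a composition array pattern.

candidate : ∀ {e es} xs → length xs ≡ suc (length es) → cnt e xs ≤ cnt e (e ∷ es) → ∃[ x ] x ∈ xs × x ≤ e
candidate {e} {es} xs len enough with All.all? (e <?_) xs
-- All of `xs` would be counted at threshold `e`, one entry more than `e ∷ es` allows, as `e` does
-- not exceed itself.
... | yes e<xs = contradiction
  (≤-trans (≤-trans (≤-reflexive (trans (sym len) (sym (cnt-all e<xs)))) enough)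
    (≤-trans (≤-reflexive (cong (_+ cnt e es) (exceeds-≤ (≤-refl {e})))) (cnt≤length e es)))
  1+n≰n
... | no ¬e<xs with x , x∈ , ¬e<x ← find (All.¬All⇒Any¬ (e <?_) xs ¬e<xs) = x , x∈ , ≮⇒≥ ¬e<x

module _ (v : Vec ℕ m) where

  private
    b = 0 ∷ v

  -- The invariant of the fold with entries `es` still to place. `greedy` says that a value was put
  -- left of a fitting position only when that position held a value no larger. `room` and `enough`
  -- say that the bounds at the vacant positions, once sorted, are dominated by the sorted remaining
  -- entries, so a fitting position is always found.
  record Greedy (o : Vec (Maybe ℕ) (suc m)) (es : List ℕ) : Set where
    field
      fits    : ∀ r {x} → lookup o r ≡ just x → lookup b r ≤ x
      greedy  : ∀ r s {x} → r Fin.< s → lookup o r ≡ just x → lookup b s ≤ x →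
                ∃[ y ] lookup o s ≡ just y × y ≤ x
      small   : ∀ r {x} → lookup o r ≡ just x → All (x ≤_) es
      room    : length (free b o) ≡ length es
      enough  : ∀ c → cnt c (free b o) ≤ cnt c es

  module _ {e es o} (asc : AllPairs _≤_ (e ∷ es)) (g : Greedy o (e ∷ es)) where
    open Greedy g

    greedy-placement : Placement e b o (place v o e)
    greedy-placement
      with x , x∈ , x≤e ← candidate {es = es} (free b o) room (enough e)
      with r , or , refl ← free⁻ b o x∈ =
      place-placement e v o r x≤e or

    private
      p = greedy-placement
      o′ = place v o e
      module P = Placement p

    greedy-step : Greedy o′ es
    greedy-step = record
      { fits   = fits′
      ; greedy = greedy′
      ; small  = small′
      ; room   = suc-injective (trans (sym (↭-length (free-placement p b))) room)
      ; enough = enough′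
      }
      where
      fits′ : ∀ r {x} → lookup o′ r ≡ just x → lookup b r ≤ x
      fits′ r eq with placement-entry p r eq
      ... | inj₁ (refl , refl) = P.fits
      ... | inj₂ (_ , eq′)     = fits r eq′

      small′ : ∀ r {x} → lookup o′ r ≡ just x → All (x ≤_) es
      small′ r eq with placement-entry p r eq
      ... | inj₁ (refl , refl) = AllPairs.head asc
      ... | inj₂ (_ , eq′)     = All.tail (small r eq′)

      stays : ∀ s {y} → lookup o s ≡ just y → lookup o′ s ≡ just y
      stays s eq = trans (elsewhere p λ { refl → contradiction (trans (sym P.vacant) eq) λ () }) eq

      greedy′ : ∀ r s {x} → r Fin.< s → lookup o′ r ≡ just x → lookup b s ≤ x →
                ∃[ y ] lookup o′ s ≡ just y × y ≤ x
      greedy′ r s r<s eq bs≤x with placement-entry p r eq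
      greedy′ r s r<s eq bs≤x | inj₂ (_ , eq′)
        with y , os , y≤x ← greedy r s r<s eq′ bs≤x = y , stays s os , y≤x
      -- For the entry just placed, a fitting position to the right is occupied by `rightmost`, and
      -- its value is at most `e` by `small`.
      greedy′ r s r<s eq bs≤x | inj₁ (refl , refl) with just-or-nothing (lookup o s)
      ... | inj₁ vac      = contradiction vac (P.rightmost s r<s bs≤x)
      ... | inj₂ (y , os) = y , stays s os , All.head (small s os)

      -- Below `e` every remaining entry is counted, so equal lengths suffice. From `e` on, neither
      -- `e` nor the bound at its position is counted, so both counts are unchanged.
      enough′ : ∀ c → cnt c (free b o′) ≤ cnt c es
      enough′ c with <-≤-connex c e
      ... | inj₁ c<e = begin
        cnt c (free b o′)    ≤⟨ cnt≤length c (free b o′) ⟩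
        length (free b o′)   ≡⟨ suc-injective (trans (sym (↭-length (free-placement p b))) room) ⟩
        length es            ≡⟨ cnt-all (All.map (<-≤-trans c<e) (AllPairs.head asc)) ⟨
        cnt c es             ∎
        where open ≤-Reasoning
      ... | inj₂ e≤c = begin
        cnt c (free b o′)                        ≡⟨ cong (_+ cnt c (free b o′)) (exceeds-≤ (≤-trans P.fits e≤c)) ⟨
        cnt c (lookup b P.pos ∷ free b o′)       ≡⟨ cnt-↭ c (free-placement p b) ⟨
        cnt c (free b o)                         ≤⟨ enough c ⟩
        cnt c (e ∷ es)                           ≡⟨ cong (_+ cnt c es) (exceeds-≤ e≤c) ⟩
        cnt c es                                 ∎
        where open ≤-Reasoning

    occupied-step : occupied o′ ++ es ↭ occupied o ++ e ∷ es
    occupied-step = ↭-trans (Perm.++⁺ʳ es (occupied-placement p)) (↭-sym (Perm.shift e (occupied o) es))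

  fill : ∀ es o → AllPairs _≤_ es → Greedy o es →
         Greedy (foldl (place v) o es) [] × occupied (foldl (place v) o es) ↭ occupied o ++ es
  fill []       o asc g = g , ↭-sym (Perm.++-identityʳ _)
  fill (e ∷ es) o asc g with g′ , p ← fill es (place v o e) (AllPairs.tail asc) (greedy-step asc g) =
    g′ , ↭-trans p (occupied-step asc g)

  -- `enough` is the lower half of `Strip`; the conditions on occupied positions are vacuous.
  vacant-greedy : ∀ (u : Vec ℕ (suc m)) → Strip u v → Greedy (replicate _ nothing) (ascending u)
  vacant-greedy u strip = record
    { fits   = λ r → absurd r
    ; greedy = λ r s _ → absurd r
    ; small  = λ r → absurd r
    ; room   = trans (cong length (free-vacant b)) (trans (Vec.length-toList b)
                 (sym (trans (↭-length (ascending-↭ u)) (Vec.length-toList u))))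
    ; enough = λ c → begin
        cnt c (free b (replicate _ nothing)) ≡⟨ cong (cnt c) (free-vacant b) ⟩
        cnt c (0 ∷ toList v)                 ≡⟨ cnt-0∷ c (toList v) ⟩
        cnt c (toList v)                     ≤⟨ proj₁ (strip c) ⟩
        cnt c (toList u)                     ≡⟨ cnt-↭ c (ascending-↭ u) ⟨
        cnt c (ascending u)                  ∎
    }
    where
    open ≤-Reasoning
    absurd : ∀ {B : Set} r {x : ℕ} → lookup (replicate (suc m) nothing) r ≡ just x → B
    absurd r eq = contradiction (trans (sym (lookup-replicate r nothing)) eq) λ ()

  module _ (u : Vec ℕ (suc m)) (strip : Strip u v) where

    private
      o = foldl (place v) (replicate (suc m) nothing) (ascending u)
      w = rearrange v u

      filled : Greedy o [] × occupied o ↭ occupied (replicate (suc m) nothing) ++ ascending u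
      filled = fill (ascending u) (replicate _ nothing) (ascending-sorted u) (vacant-greedy u strip)

      open Greedy (proj₁ filled)

      full : ∀ r → lookup o r ≢ nothing
      full = no-vacancy b o (empty (free b o) room)
        where
        empty : ∀ (xs : List ℕ) → length xs ≡ 0 → [] ↭ xs
        empty [] _ = ↭-refl

      entry-o : ∀ r → lookup o r ≡ just (lookup w r)
      entry-o r with just-or-nothing (lookup o r)
      ... | inj₁ vac      = contradiction vac (full r)
      ... | inj₂ (y , eq) = trans eq
        (cong just (sym (trans (lookup-map r (fromMaybe 0) o) (cong (fromMaybe 0) eq))))

    rearrange-↭ : toList (rearrange v u) ↭ toList u
    rearrange-↭ rewrite sym (occupied-full o full) =
      ↭-trans (proj₂ filled)
        (subst (λ xs → xs ++ ascending u ↭ toList u) (sym (occupied-vacant (suc m))) (ascending-↭ u))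

    rearrange-CAPRows : CAPRows (rearrange v u) v
    rearrange-CAPRows = b≤w , λ r s r<s → disjoint⇒Triple w v b≤w r s (disjoint r s r<s)
      where
      b≤w : ∀ r → lookup b r ≤ lookup w r
      b≤w r = fits r (entry-o r)

      ws≤wr : ∀ r s → r Fin.< s → lookup b s ≤ lookup w r → lookup w s ≤ lookup w r
      ws≤wr r s r<s bs≤wr with y , os , y≤ ← greedy r s r<s (entry-o r) bs≤wr
        with refl ← just-injective (trans (sym os) (entry-o s)) = y≤

      disjoint : ∀ r s → r Fin.< s → ∀ c → Added c (lookup b s) (lookup w s) →
                 lookup b r ≤ c → ¬ c ≤ lookup w r
      disjoint r s r<s c (bs≤c , c<ws) br≤c c≤wr = <-irrefl refl (begin-strict
        cnt c (toList u)           ≤⟨ proj₂ (strip c) ⟩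
        suc (cnt c (toList v))     ≡⟨ cong suc (cnt-0∷ c (toList v)) ⟨
        -- Here b_s ≤ c ≤ w_r, so greediness gives c < w_s ≤ w_r: column `c` is new in row `r` as
        -- well.
        suc (cnt c (toList b))     <⟨ two-Added c b w b≤w r s r<s
                                       (br≤c , <-≤-trans c<ws (ws≤wr r s r<s (≤-trans bs≤c c≤wr))) (bs≤c , c<ws) ⟩
        cnt c (toList w)           ≡⟨ cnt-↭ c rearrange-↭ ⟩
        cnt c (toList u)           ∎)
        where open ≤-Reasoning

-- The bijection

row₁-Θ : (X : Triangle n) → row₁ (Θ X) ≡ row₁ X ~
row₁-Θ []      = refl
row₁-Θ (u ∷ X) = refl

Θ-GT : (X : Triangle n) → ConsecutiveRows CAPRows X → ConsecutiveRows GTRows (Θ X)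
Θ-GT []      _            = tt
Θ-GT (u ∷ X) (cap , caps) = subst (GTRows (u ~)) (sym (row₁-Θ X)) (CAPRows⇒GTRows u (row₁ X) cap) , Θ-GT X caps

Θ̃∘Θ : (X : Triangle n) → ConsecutiveRows CAPRows X → Θ̃ (Θ X) ≡ X
Θ̃∘Θ []      _            = refl
Θ̃∘Θ (u ∷ X) (cap , caps) rewrite Θ̃∘Θ X caps =
  cong (_∷ X) (rearrange-unique u (row₁ X) cap (u ~) (~-↭ u))

-- Counts ignore order, so the strip condition passes from the sorted lower row to the rearranged
-- one.
GTRows-~⇒Strip : (u : Vec ℕ (suc m)) (v : Vec ℕ m) → GTRows u (v ~) → Strip u v
GTRows-~⇒Strip u v gt c = subst (λ k → k ≤ cnt c (toList u) × cnt c (toList u) ≤ suc k)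
  (cnt-↭ c (~-↭ v)) (GTRows⇒Strip u (v ~) gt c)

-- Declared ahead of its proof: rearranging a row requires that the rearranged row below sorts back
-- to that of `Y`, which is this statement for the smaller triangle.
Θ∘Θ̃ : (Y : Triangle n) → ConsecutiveRows GTRows Y → Θ (Θ̃ Y) ≡ Y

row₁-Θ̃ : (Y : Triangle n) → ConsecutiveRows GTRows Y → row₁ (Θ̃ Y) ~ ≡ row₁ Y
row₁-Θ̃ Y gts = trans (sym (row₁-Θ (Θ̃ Y))) (cong row₁ (Θ∘Θ̃ Y gts))

Θ̃-Strip : (u : Vec ℕ (suc n)) (Y : Triangle n) → ConsecutiveRows GTRows (u ∷ Y) → Strip u (row₁ (Θ̃ Y))
Θ̃-Strip u Y (gt , gts) = GTRows-~⇒Strip u (row₁ (Θ̃ Y)) (subst (GTRows u) (sym (row₁-Θ̃ Y gts)) gt)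

Θ∘Θ̃ []      _            = refl
Θ∘Θ̃ (u ∷ Y) (gt , gts) = cong₂ _∷_
  (~-unique _ u (rearrange-↭ (row₁ (Θ̃ Y)) u (Θ̃-Strip u Y (gt , gts))) (GTRows⇒descending u (row₁ Y) gt))
  (Θ∘Θ̃ Y gts)

Θ̃-CAP : (Y : Triangle n) → ConsecutiveRows GTRows Y → ConsecutiveRows CAPRows (Θ̃ Y)
Θ̃-CAP []      _          = tt
Θ̃-CAP (u ∷ Y) (gt , gts) = rearrange-CAPRows (row₁ (Θ̃ Y)) u (Θ̃-Strip u Y (gt , gts)) , Θ̃-CAP Y gts

Θ-inverses : (μ : Vec ℕ n) → Inverses (IsCAPSortingTo μ) (IsGT μ) Θ Θ̃
Θ-inverses μ = record
  { to       = λ { {X} (_ , refl , refl , caps) → row₁-Θ X , Θ-GT X caps }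
  ; from     = λ { {Y} (refl , gts) → row₁ (Θ̃ Y) , row₁-Θ̃ Y gts , refl , Θ̃-CAP Y gts }
  ; inverseˡ = λ { {Y} (_ , gts) → Θ∘Θ̃ Y gts }
  ; inverseʳ = λ { {X} (_ , _ , _ , caps) → Θ̃∘Θ X caps }
  }

-- Transposition of fillings

lengths : Filling → List ℕ
lengths = map length

length-column : ∀ T j → length (column T j) ≡ cnt j (lengths T)
length-column []      j = refl
length-column (r ∷ T) j with <-≤-connex j (length r)
... | inj₁ j<l with a , eq ← nth-< r j<l rewrite eq | exceeds-> j<l = cong suc (length-column T j)
... | inj₂ l≤j rewrite nth-≥ r l≤j | exceeds-≤ l≤j = length-column T j

length-0 : ∀ {xs : List A} → length xs ≡ 0 → xs ≡ []
length-0 {xs = []} _ = refl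

column-[] : ∀ T j → All (_≤ j) (lengths T) → column T j ≡ []
column-[] T j short = length-0 (trans (length-column T j) (cnt-none short))

-- `columns` stops where the columns become empty, so an empty column corresponds to an absent row
-- of the transpose.
nonempty : List A → Maybe (List A)
nonempty []       = nothing
nonempty (x ∷ xs) = just (x ∷ xs)

nonempty-> : ∀ {xs : List A} → 0 < length xs → nonempty xs ≡ just xs
nonempty-> {xs = x ∷ xs} _ = refl

width : Filling → ℕ
width T = max 0 (lengths T)

-- If column `k` were empty, no row would be longer than `k`.
<width⇒column : ∀ T {k} → k < width T → 0 < length (column T k)
<width⇒column T {k} k<w rewrite length-column T k = n≢0⇒n>0 λ eq →
  <-irrefl refl (<-≤-trans k<w (max≤v⁺ z≤n (cnt-zero⇒All (lengths T) eq)))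

nth-columns : ∀ T k → nth (columns T) k ≡ nonempty (column T k)
nth-columns T k with <-≤-connex k (width T)
... | inj₁ k<w = trans (nth-applyUpTo (column T) k<w) (sym (nonempty-> (<width⇒column T k<w)))
... | inj₂ w≤k = trans (nth-≥ (columns T) (≤-trans (≤-reflexive (List.length-applyUpTo (column T) (width T))) w≤k))
  (sym (cong nonempty (column-[] T k (All.map (λ l≤w → ≤-trans l≤w w≤k) (xs≤max 0 (lengths T))))))

columns-descending : ∀ T → Descending (lengths (columns T))
columns-descending T = AllPairs.map⁺ (AllPairs.applyUpTo⁺₁ (column T) (width T) λ {i} {j} i<j _ → begin
  length (column T j)  ≡⟨ length-column T j ⟩
  cnt j (lengths T)    ≤⟨ cnt-antimono (lengths T) (<⇒≤ i<j) ⟩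
  cnt i (lengths T)    ≡⟨ length-column T i ⟨
  length (column T i)  ∎)
  where open ≤-Reasoning

columns-All : ∀ {P : List ℕ → Set} T → (∀ k → k < width T → P (column T k)) → All P (columns T)
columns-All T P = All.applyUpTo⁺₁ (column T) (width T) λ {i} → P i

nth₂ : Filling → ℕ → ℕ → Maybe ℕ
nth₂ T j k = nth T j Maybe.>>= λ r → nth r k

nth₂-short : ∀ T j {k} → All (_≤ k) (lengths T) → nth₂ T j k ≡ nothing
nth₂-short []      zero    _           = refl
nth₂-short []      (suc j) _           = refl
nth₂-short (r ∷ T) zero    (l≤k ∷ _)   = nth-≥ r l≤k
nth₂-short (r ∷ T) (suc j) (_ ∷ short) = nth₂-short T j short

-- In a partition shape the rows meeting column `k` come first, so position `j` of the column lies
-- in row `j`.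
nth-column : ∀ T → Descending (lengths T) → ∀ k j → nth (column T k) j ≡ nth₂ T j k
nth-column []      _ k zero    = refl
nth-column []      _ k (suc j) = refl
nth-column (r ∷ T) d k j with <-≤-connex k (length r)
... | inj₂ l≤k = trans
  (cong (λ xs → nth xs j) (column-[] (r ∷ T) k (descending-head d l≤k)))
  (trans (nth-[] j) (sym (nth₂-short (r ∷ T) j (descending-head d l≤k))))
nth-column (r ∷ T) d k j | inj₁ k<l with a , eq ← nth-< r k<l with j
... | zero  rewrite eq = refl
... | suc j rewrite eq = nth-column T (AllPairs.tail d) k j

column-columns : ∀ T → Descending (lengths T) → ∀ j → column (columns T) j ≡ fromMaybe [] (nth T j)
column-columns T d j = nth-ext λ k → begin
  nth (column (columns T) j) k                              ≡⟨ nth-column (columns T) (columns-descending T) j k ⟩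
  (nth (columns T) k Maybe.>>= λ r → nth r j)               ≡⟨ cong (Maybe._>>= λ r → nth r j) (nth-columns T k) ⟩
  (nonempty (column T k) Maybe.>>= λ r → nth r j)           ≡⟨ nonempty-nth (column T k) j ⟩
  nth (column T k) j                                        ≡⟨ nth-column T d k j ⟩
  (nth T j Maybe.>>= λ r → nth r k)                         ≡⟨ fromMaybe-nth (nth T j) k ⟩
  nth (fromMaybe [] (nth T j)) k                            ∎
  where
  open ≡-Reasoning
  nonempty-nth : ∀ (xs : List ℕ) j → (nonempty xs Maybe.>>= λ r → nth r j) ≡ nth xs j
  nonempty-nth []       j = sym (nth-[] j)
  nonempty-nth (x ∷ xs) j = refl
  fromMaybe-nth : ∀ (r : Maybe (List ℕ)) k → (r Maybe.>>= λ r → nth r k) ≡ nth (fromMaybe [] r) k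
  fromMaybe-nth nothing  k = sym (nth-[] k)
  fromMaybe-nth (just r) k = refl

-- Transposition is an involution on partition shapes; empty rows are excluded because `columns`
-- never yields one.
columns-involutive : ∀ T → Descending (lengths T) → All ((0 <_) ∘ length) T → columns (columns T) ≡ T
columns-involutive T d ne = nth-ext λ j → trans (nth-columns (columns T) j)
  (trans (cong nonempty (column-columns T d j)) (restore j))
  where
  restore : ∀ j → nonempty (fromMaybe [] (nth T j)) ≡ nth T j
  restore j with nth T j in eq
  ... | nothing = refl
  ... | just r  = nonempty-> (nth-All j ne eq)

sort↓-[] : ∀ (r : List ℕ) → nonempty (sort↓ r) ≡ Maybe.map sort↓ (nonempty r)
sort↓-[] []      = refl
sort↓-[] (x ∷ r) = nonempty-> (≤-trans z<s (≤-reflexive (sym (↭-length (sort↓-↭ (x ∷ r))))))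

nth-sorted-columns : ∀ U j → nth (map sort↓ (columns U)) j ≡ nonempty (sort↓ (column U j))
nth-sorted-columns U j = trans (nth-map sort↓ (columns U) j)
  (trans (cong (Maybe.map sort↓) (nth-columns U j)) (sym (sort↓-[] (column U j))))

sorted-columns-descending : ∀ U → Descending (lengths (map sort↓ (columns U)))
sorted-columns-descending U = subst Descending
  (trans (List.map-cong (λ r → sym (↭-length (sort↓-↭ r))) (columns U)) (List.map-∘ (columns U)))
  (columns-descending U)

column-θ : ∀ U j → column (θ U) j ≡ sort↓ (column U j)
column-θ U j = trans (column-columns _ (sorted-columns-descending U) j)
  (trans (cong (fromMaybe []) (nth-sorted-columns U j)) (from-nonempty (sort↓ (column U j))))
  where
  from-nonempty : ∀ (r : List ℕ) → fromMaybe [] (nonempty r) ≡ r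
  from-nonempty []      = refl
  from-nonempty (x ∷ r) = refl

-- The sorted columns of `U` form the list `columns T`, and transposing that list gives `T` back.
θ-unique : ∀ U T → Descending (lengths T) → All ((0 <_) ∘ length) T →
           (∀ j → sort↓ (column U j) ≡ column T j) → θ U ≡ T
θ-unique U T d ne eq = trans (cong columns (nth-ext λ j → begin
  nth (map sort↓ (columns U)) j   ≡⟨ nth-sorted-columns U j ⟩
  nonempty (sort↓ (column U j))   ≡⟨ cong nonempty (eq j) ⟩
  nonempty (column T j)           ≡⟨ nth-columns T j ⟨
  nth (columns T) j               ∎)) (columns-involutive T d ne)
  where open ≡-Reasoning

AllPairs-mapMaybe : ∀ {B : Set} {R : B → B → Set} (f : A → Maybe B) {xs} →
  AllPairs (λ x y → ∀ {a b} → f x ≡ just a → f y ≡ just b → R a b) xs → AllPairs R (mapMaybe f xs)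
AllPairs-mapMaybe f []                       = []
AllPairs-mapMaybe {R = R} f {x ∷ xs} (Rx ∷ Rxs) with f x
... | nothing = AllPairs-mapMaybe f Rxs
... | just a  = heads Rx ∷ AllPairs-mapMaybe f Rxs
  where
  heads : ∀ {ys} → All (λ y → ∀ {a′ b} → just a ≡ just a′ → f y ≡ just b → R a′ b) ys →
          All (R a) (mapMaybe f ys)
  heads []                  = []
  heads {y ∷ ys} (Ry ∷ Rys) with f y
  ... | nothing = heads Rys
  ... | just b  = Ry refl refl ∷ heads Rys

All-column : ∀ {P : ℕ → Set} {T} j → All (All P) T → All P (column T j)
All-column         j []                    = []
All-column {T = r ∷ T} j (pr ∷ pT) with nth r j in eq
... | nothing = All-column j pT
... | just a  = nth-All j pr eq ∷ All-column j pT

-- The fillings of patterns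

data EntryOfExtension (i : ℕ) (r : List ℕ) (k j : ℕ) : Maybe ℕ → Set where
  old     : ∀ {a} → j < length r → nth r j ≡ just a → EntryOfExtension i r k j (just a)
  new     : Added j (length r) k → nth r j ≡ nothing → EntryOfExtension i r k j (just i)
  outside : k ≤ j → nth r j ≡ nothing → EntryOfExtension i r k j nothing

module _ (i : ℕ) where

  length-extend : ∀ r {k} → length r ≤ k → length (extend i r k) ≡ k
  length-extend r {k} l≤k = trans (List.length-++ r)
    (trans (cong (length r +_) (List.length-replicate (k ∸ length r))) (m+[n∸m]≡n l≤k))

  extend-entry : ∀ r {k} j → length r ≤ k → EntryOfExtension i r k j (nth (extend i r k) j)
  extend-entry r {k} j l≤k with <-≤-connex j (length r) | <-≤-connex j k
  ... | inj₁ j<l | _ with a , eq ← nth-< r j<l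
    rewrite nth-++ˡ r {List.replicate (k ∸ length r) i} j<l | eq =
    old j<l eq
  ... | inj₂ l≤j | inj₁ j<k
    rewrite nth-++ʳ r {List.replicate (k ∸ length r) i} l≤j | nth-replicate {a = i} (∸-monoˡ-< j<k l≤j) =
    new (l≤j , j<k) (nth-≥ r l≤j)
  ... | inj₂ l≤j | inj₂ k≤j
    rewrite nth-≥ (extend i r k) (≤-trans (≤-reflexive (length-extend r l≤k)) k≤j) =
    outside k≤j (nth-≥ r l≤j)

  Row : List ℕ → Set
  Row r = All (i ≤_) r × Descending r

module _ {i : ℕ} where

  private
    weaken : ∀ {r} → All (suc i ≤_) r → All (i ≤_) r
    weaken = All.map (≤-trans (n≤1+n i))

  replicate-descending : ∀ n → Descending (List.replicate n i)
  replicate-descending zero    = []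
  replicate-descending (suc n) = All.replicate⁺ n ≤-refl ∷ replicate-descending n

  -- Larger entries are placed at earlier stages, so the copies of `i` go after entries exceeding
  -- `i`.
  extend-Row : ∀ {r} k → Row (suc i) r → Row i (extend i r k)
  extend-Row {r} k (i<r , d) =
    All.++⁺ (weaken i<r) (All.replicate⁺ _ ≤-refl) ,
    AllPairs.++⁺ d (replicate-descending _) (All.map (All.replicate⁺ _) (weaken i<r))

  extend-Rows : ∀ {k} (R : Vec (List ℕ) k) (u : Vec ℕ k) → All (Row (suc i)) (toList R) →
                All (Row i) (toList (Vec.zipWith (extend i) R u))
  extend-Rows []      []      []          = []
  extend-Rows (r ∷ R) (k ∷ u) (row ∷ rows) = extend-Row k row ∷ extend-Rows R u rows

  -- New boxes may lie between old ones, so the column is described only up to order. Their number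
  -- `d` is pinned down later by comparing lengths.
  column-extend : ∀ {k} (R : Vec (List ℕ) k) (u : Vec ℕ k) →
    (∀ r → length (lookup R r) ≤ lookup u r) → ∀ j →
    ∃[ d ] column (toList (Vec.zipWith (extend i) R u)) j ↭ column (toList R) j ++ List.replicate d i
  column-extend []      []      l≤ j = 0 , ↭-refl
  column-extend (r ∷ R) (k ∷ u) l≤ j
    with d , p ← column-extend R u (l≤ ∘ suc) j | nth (extend i r k) j | extend-entry i r j (l≤ zero)
  ... | _ | old {a} _ eq rewrite eq = d , ↭-prep a p
  ... | _ | new _ eq     rewrite eq =
    suc d , ↭-trans (↭-prep i p) (↭-sym (Perm.shift i (column (toList R) j) (List.replicate d i)))
  ... | _ | outside _ eq rewrite eq = d , p

  lengths-extend : ∀ {k} (R : Vec (List ℕ) k) (u : Vec ℕ k) → (∀ r → length (lookup R r) ≤ lookup u r) →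
                   ∀ r → length (lookup (Vec.zipWith (extend i) R u) r) ≡ lookup u r
  lengths-extend R u l≤ r rewrite Vec.lookup-zipWith (extend i) r R u = length-extend i (lookup R r) (l≤ r)

HasLengths : Vec (List ℕ) k → Vec ℕ k → Set
HasLengths R u = ∀ r → length (lookup R r) ≡ lookup u r

HasLengths⇒≡ : (R : Vec (List ℕ) k) (u : Vec ℕ k) → HasLengths R u → lengths (toList R) ≡ toList u
HasLengths⇒≡ []      []      _  = refl
HasLengths⇒≡ (r ∷ R) (x ∷ u) eq = cong₂ _∷_ (eq zero) (HasLengths⇒≡ R u (eq ∘ suc))

[]∷-lengths : ∀ (R : Vec (List ℕ) m) {v} (u : Vec ℕ (suc m)) → HasLengths R v →
              (∀ r → lookup (0 ∷ v) r ≤ lookup u r) →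
              ∀ r → length (lookup ([] ∷ R) r) ≤ lookup u r
[]∷-lengths R u eq b≤u zero    = z≤n
[]∷-lengths R u eq b≤u (suc r) = ≤-trans (≤-reflexive (eq r)) (b≤u (suc r))

∷ʳ[]-lengths : ∀ (R : Vec (List ℕ) m) v (u : Vec ℕ (suc m)) → HasLengths R v → GTRows u v →
               ∀ r → length (lookup (R Vec.∷ʳ []) r) ≤ lookup u r
∷ʳ[]-lengths []      []      u       eq gt zero    = z≤n
∷ʳ[]-lengths (r ∷ R) (y ∷ v) (x ∷ u) eq gt zero    = ≤-trans (≤-reflexive (eq zero)) (proj₁ (gt zero))
∷ʳ[]-lengths (r ∷ R) (y ∷ v) (x ∷ u) eq gt (suc s) = ∷ʳ[]-lengths R v u (eq ∘ suc) (gt ∘ suc) s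

ψ-lengths : ∀ i (X : Triangle n) → ConsecutiveRows CAPRows X → HasLengths (ψ-rows i X) (row₁ X)
ψ-bounds : ∀ i (u : Vec ℕ (suc n)) (X : Triangle n) → ConsecutiveRows CAPRows (u ∷ X) →
           ∀ r → length (lookup ([] ∷ ψ-rows (suc i) X) r) ≤ lookup u r
ψ-lengths i (u ∷ X) caps = lengths-extend ([] ∷ ψ-rows (suc i) X) u (ψ-bounds i u X caps)
ψ-bounds i u X (cap , caps) = []∷-lengths (ψ-rows (suc i) X) u (ψ-lengths (suc i) X caps) (proj₁ cap)

φ-lengths : ∀ i (Y : Triangle n) → ConsecutiveRows GTRows Y → HasLengths (φ-rows i Y) (row₁ Y)
φ-bounds : ∀ i (u : Vec ℕ (suc n)) (Y : Triangle n) → ConsecutiveRows GTRows (u ∷ Y) →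
           ∀ r → length (lookup (φ-rows (suc i) Y Vec.∷ʳ []) r) ≤ lookup u r
φ-lengths i (u ∷ Y) gts = lengths-extend (φ-rows (suc i) Y Vec.∷ʳ []) u (φ-bounds i u Y gts)
φ-bounds i u Y (gt , gts) = ∷ʳ[]-lengths (φ-rows (suc i) Y) (row₁ Y) u (φ-lengths (suc i) Y gts) gt

ψ-Rows : ∀ i (X : Triangle n) → All (Row i) (toList (ψ-rows i X))
ψ-Rows i []      = []
ψ-Rows i (u ∷ X) = extend-Rows ([] ∷ ψ-rows (suc i) X) u (([] , []) ∷ ψ-Rows (suc i) X)

φ-Rows : ∀ i (Y : Triangle n) → All (Row i) (toList (φ-rows i Y))
φ-Rows i []      = []
φ-Rows i (u ∷ Y) = extend-Rows (φ-rows (suc i) Y Vec.∷ʳ []) u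
  (subst (All (Row (suc i))) (sym (Vec.toList-∷ʳ [] (φ-rows (suc i) Y)))
    (All.++⁺ (φ-Rows (suc i) Y) (([] , []) ∷ [])))

column-[]∷ : ∀ T j → column ([] ∷ T) j ≡ column T j
column-[]∷ T j rewrite nth-[] {ℕ} j = refl

column-∷ʳ[] : ∀ (R : Vec (List ℕ) m) j → column (toList (R Vec.∷ʳ [])) j ≡ column (toList R) j
column-∷ʳ[] []      j rewrite nth-[] {ℕ} j = refl
column-∷ʳ[] (r ∷ R) j = cong (maybe′ _∷_ id (r at j)) (column-∷ʳ[] R j)

column-length : ∀ (R : Vec (List ℕ) k) u → HasLengths R u → ∀ j → length (column (toList R) j) ≡ cnt j (toList u)
column-length R u eq j = trans (length-column (toList R) j) (cong (cnt j) (HasLengths⇒≡ R u eq))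

length-++-replicate : ∀ {xs zs : List ℕ} d {i} → xs ↭ zs ++ List.replicate d i → length xs ≡ length zs + d
length-++-replicate {zs = zs} d p =
  trans (↭-length p) (trans (List.length-++ zs) (cong (length zs +_) (List.length-replicate d)))

++-replicate-↭ : ∀ {xs ys} (zs : List ℕ) d e {i} →
                 xs ↭ zs ++ List.replicate d i → ys ↭ zs ++ List.replicate e i →
                 length xs ≡ length ys → xs ↭ ys
++-replicate-↭ zs d e p q len
  with refl ← +-cancelˡ-≡ (length zs) d e
    (trans (sym (length-++-replicate d p)) (trans len (length-++-replicate e q))) = ↭-trans p (↭-sym q)

columns-ψφ : ∀ i (X : Triangle n) → ConsecutiveRows CAPRows X → ∀ j →
             column (toList (ψ-rows i X)) j ↭ column (toList (φ-rows i (Θ X))) j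
columns-ψφ i []        _                  j = ↭-refl
columns-ψφ i X@(u ∷ X′) caps@(_ , caps′) j
  with d , p ← column-extend ([] ∷ ψ-rows (suc i) X′) u (ψ-bounds i u X′ caps) j
     | e , q ← column-extend (φ-rows (suc i) (Θ X′) Vec.∷ʳ []) (u ~) (φ-bounds i (u ~) (Θ X′) (Θ-GT X caps)) j
  rewrite column-∷ʳ[] (φ-rows (suc i) (Θ X′)) j
        | column-[]∷ (toList (ψ-rows (suc i) X′)) j =
  ++-replicate-↭ (column (toList (ψ-rows (suc i) X′)) j) d e
    p (↭-trans q (Perm.++⁺ʳ _ (↭-sym (columns-ψφ (suc i) X′ caps′ j))))
    (begin
      length (column (toList (ψ-rows i X)) j)      ≡⟨ column-length (ψ-rows i X) u (ψ-lengths i X caps) j ⟩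
      cnt j (toList u)                             ≡⟨ cnt-↭ j (~-↭ u) ⟨
      cnt j (toList (u ~))                         ≡⟨ column-length (φ-rows i (Θ X)) (u ~) φ-len j ⟨
      length (column (toList (φ-rows i (Θ X))) j)  ∎)
  where
  open ≡-Reasoning
  φ-len = φ-lengths i (Θ X) (Θ-GT X caps)

-- The first part of `u` is its largest, and the lower half of `Strip` carries emptiness over to the
-- inner shape.
φ-columns-[] : ∀ {i} (R : Vec (List ℕ) m) v (u : Vec ℕ (suc m)) → HasLengths R v → GTRows u v → ∀ {j} →
  lookup u zero ≤ j →
  column (toList (Vec.zipWith (extend i) (R Vec.∷ʳ []) u)) j ≡ [] × column (toList R) j ≡ []
φ-columns-[] {i = i} R v u@(x ∷ _) eq gt {j} x≤j =
  length-0 (trans (column-length (Vec.zipWith (extend i) (R Vec.∷ʳ []) u) u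
    (lengths-extend (R Vec.∷ʳ []) u (∷ʳ[]-lengths R v u eq gt)) j) none) ,
  length-0 (trans (column-length R v eq j) (n≤0⇒n≡0 (≤-trans (proj₁ (GTRows⇒Strip u v gt j)) (≤-reflexive none))))
  where
  none : cnt j (toList u) ≡ 0
  none = cnt-none (descending-head (GTRows⇒descending u v gt) x≤j)

-- Unlike in `column-extend`, the new box comes last. Once a row has no old box in column `j`, the
-- next part of `u` is at most the old length of that row, hence at most `j`, and the rest of the
-- column is empty.
φ-column-extend : ∀ {i} (R : Vec (List ℕ) m) v (u : Vec ℕ (suc m)) → HasLengths R v → GTRows u v → ∀ j →
  ∃[ d ] column (toList (Vec.zipWith (extend i) (R Vec.∷ʳ []) u)) j ≡ column (toList R) j ++ List.replicate d i
         × d ≤ 1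
φ-column-extend {i = i} []      []      (x ∷ []) eq gt j with nth (extend i [] x) j | extend-entry i [] {x} j z≤n
... | _ | old () _
... | _ | new _ _     = 1 , refl , ≤-refl
... | _ | outside _ _ = 0 , refl , z≤n
φ-column-extend {i = i} (r ∷ R) (y ∷ v) (x ∷ u) eq gt j
  with nth (extend i r x) j | extend-entry i r {x} j (∷ʳ[]-lengths (r ∷ R) (y ∷ v) (x ∷ u) eq gt zero)
... | _ | old {a} _ at-j rewrite at-j with d , eq′ , d≤1 ← φ-column-extend R v u (eq ∘ suc) (gt ∘ suc) j =
  d , cong (a ∷_) eq′ , d≤1
... | _ | new (l≤j , _) at-j rewrite at-j
  with c , c′ ← φ-columns-[] {i = i} R v u (eq ∘ suc) (gt ∘ suc)
    (≤-trans (proj₂ (gt zero)) (≤-trans (≤-reflexive (sym (eq zero))) l≤j))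
  rewrite c | c′ = 1 , refl , ≤-refl
... | _ | outside x≤j at-j rewrite at-j
  with c , c′ ← φ-columns-[] {i = i} R v u (eq ∘ suc) (gt ∘ suc)
    (≤-trans (proj₂ (gt zero)) (≤-trans (proj₁ (gt zero)) x≤j))
  rewrite c | c′ = 0 , refl , z≤n

-- At most one `i` joins a column, below entries that all exceed `i`.
φ-strict : ∀ i (Y : Triangle n) → ConsecutiveRows GTRows Y → ∀ j → AllPairs _>_ (column (toList (φ-rows i Y)) j)
φ-strict i []      _          j = []
φ-strict i (u ∷ Y) (gt , gts) j
  with φ-column-extend {i = i} (φ-rows (suc i) Y) (row₁ Y) u (φ-lengths (suc i) Y gts) gt j
... | d , eq , d≤1 rewrite eq = AllPairs.++⁺ (φ-strict (suc i) Y gts j) (short d≤1)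
  (All.map (All.replicate⁺ d) (All-column j (All.map proj₁ (φ-Rows (suc i) Y))))
  where
  short : ∀ {d} → d ≤ 1 → AllPairs _>_ (List.replicate d i)
  short z≤n       = []
  short (s≤s z≤n) = [] ∷ []

-- Deleting empty rows.

dropEmpty : Filling → Filling
dropEmpty = filter ((0 <?_) ∘ length)

lengths-dropEmpty : ∀ T → lengths (dropEmpty T) ≡ filter (0 <?_) (lengths T)
lengths-dropEmpty []            = refl
lengths-dropEmpty ([] ∷ T)      = lengths-dropEmpty T
lengths-dropEmpty ((x ∷ r) ∷ T) = cong (suc (length r) ∷_) (lengths-dropEmpty T)

column-dropEmpty : ∀ T j → column (dropEmpty T) j ≡ column T j
column-dropEmpty []            j = refl
column-dropEmpty ([] ∷ T)      j = trans (column-dropEmpty T j) (sym (column-[]∷ T j))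
column-dropEmpty ((x ∷ r) ∷ T) j = cong (maybe′ _∷_ id ((x ∷ r) at j)) (column-dropEmpty T j)

cnt-positive : ∀ c xs → cnt c (filter (0 <?_) xs) ≡ cnt c xs
cnt-positive c []           = refl
cnt-positive c (zero ∷ xs)  = trans (cnt-positive c xs) (sym (cnt-0∷ c xs))
cnt-positive c (suc x ∷ xs) = cong (exceeds c (suc x) +_) (cnt-positive c xs)

nonemptyRows-shape : ∀ (R : Vec (List ℕ) n) u → HasLengths R u → lengths (nonemptyRows R) ≡ u ⁺
nonemptyRows-shape R u eq = trans (lengths-dropEmpty (toList R)) (cong (filter (0 <?_)) (HasLengths⇒≡ R u eq))

AllPairs-toList : ∀ {R : A → A → Set} (xs : Vec A n) → (∀ r s → r Fin.< s → R (lookup xs r) (lookup xs s)) →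
                  AllPairs R (toList xs)
AllPairs-toList []       _  = []
AllPairs-toList {R = R} (x ∷ xs) Rs =
  first xs (λ s → Rs zero (suc s) z<s) ∷
  AllPairs-toList xs λ r s r<s → Rs (suc r) (suc s) (s<s r<s)
  where
  first : ∀ {n} (xs : Vec _ n) → (∀ s → R x (lookup xs s)) → All (R x) (toList xs)
  first []       _  = []
  first (y ∷ ys) Rx = Rx zero ∷ first ys (Rx ∘ suc)

AllPairs-lookup : ∀ {R : A → A → Set} {xs} → AllPairs R xs →
                  ∀ r s → r Fin.< s → R (List.lookup xs r) (List.lookup xs s)
AllPairs-lookup (Rx ∷ _)  zero    (suc s) _   = All.lookup Rx (∈-lookup s)
AllPairs-lookup (_ ∷ Rxs) (suc r) (suc s) r<s = AllPairs-lookup Rxs r s (s<s⁻¹ r<s)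

lookup-AllPairs : ∀ {R : A → A → Set} xs → (∀ r s → r Fin.< s → R (List.lookup xs r) (List.lookup xs s)) →
                  AllPairs R xs
lookup-AllPairs []       _  = []
lookup-AllPairs {R = R} (x ∷ xs) Rs =
  All.tabulate (λ {y} y∈ → subst (R x) (sym (lookup-index y∈)) (Rs zero (suc (index y∈)) z<s)) ∷
  lookup-AllPairs xs λ r s r<s → Rs (suc r) (suc s) (s<s r<s)

-- The images of `ψ` and `φ` are tableaux.

value : List ℕ → ℕ → ℕ
value r j = fromMaybe 0 (r at j)

-- The third tableau condition as a relation between two rows, free of row indices, so that it
-- passes through the deletion of empty rows.
TripleRule : List ℕ → List ℕ → Set
TripleRule r s = ∀ j → value s (suc j) ≢ 0 → value s (suc j) ≥ value r (suc j) → value s (suc j) > value r j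

module _ {i : ℕ} where

  value-≤-extend : ∀ r {k} j → length r ≤ k → value r j ≤ value (extend i r k) j
  value-≤-extend r {k} j r≤k with nth (extend i r k) j | extend-entry i r j r≤k
  ... | _ | old _ eq     rewrite eq = ≤-refl
  ... | _ | new _ eq     rewrite eq = z≤n
  ... | _ | outside _ eq rewrite eq = z≤n

  value-extend : ∀ r {k} j → length r ≤ k → value (extend i r k) j ≡ value r j ⊎ value (extend i r k) j ≤ i
  value-extend r {k} j r≤k with nth (extend i r k) j | extend-entry i r j r≤k
  ... | _ | old _ eq    rewrite eq = inj₁ refl
  ... | _ | new _ _     = inj₂ ≤-refl
  ... | _ | outside _ _ = inj₂ z≤n

  value-outside : ∀ r {k} j → length r ≤ k → k ≤ j → value (extend i r k) j ≡ 0
  value-outside r {k} j r≤k k≤j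
    rewrite nth-≥ (extend i r k) (≤-trans (≤-reflexive (length-extend i r r≤k)) k≤j) = refl

  -- Old entries exceed `i`, so such a value is a new `i` or the padding 0.
  value-≤⇒length : ∀ r {k} j → All (suc i ≤_) r → length r ≤ k → value (extend i r k) j ≤ i → length r ≤ j
  value-≤⇒length r {k} j i<r r≤k a≤i with nth (extend i r k) j | extend-entry i r j r≤k
  ... | _ | old _ eq        = contradiction (≤-trans (nth-All j i<r eq) a≤i) 1+n≰n
  ... | _ | new (r≤j , _) _ = r≤j
  ... | _ | outside k≤j _   = ≤-trans r≤k k≤j

  -- If the entry of `s` is a new `i`, then `r` had no old box in that column, and `apart` leaves
  -- the extended `r` without a box even in column `j`. If it is old, it exceeds `i`, so only an old
  -- entry of `r` in column `j` matters, and the previous `rule` applies.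
  extend-TripleRule : ∀ r s {k l} → 0 < i → All (suc i ≤_) r → All (suc i ≤_) s →
    length r ≤ k → length s ≤ l →
    (∀ c → Added c (length s) l → length r ≤ c → ¬ c ≤ k) → TripleRule r s →
    TripleRule (extend i r k) (extend i s l)
  extend-TripleRule r s {k} {l} i>0 i<r i<s r≤k s≤l apart rule j ≢0 ≥r
    with nth (extend i s l) (suc j) | extend-entry i s (suc j) s≤l
  ... | _ | outside _ _     = contradiction refl ≢0
  ... | _ | new added _     = ≤-trans (s≤s (≤-reflexive (value-outside r j r≤k
    (≮⇒≥ (apart (suc j) added (value-≤⇒length r (suc j) i<r r≤k ≥r)))))) i>0
  ... | _ | old {a} _ eq with value-extend r j r≤k
  ...   | inj₂ ≤i = ≤-<-trans ≤i (nth-All (suc j) i<s eq)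
  ...   | inj₁ same = ≤-trans (s≤s (≤-reflexive same)) (subst (_> value r j) (cong (fromMaybe 0) eq)
    (rule j (≢0 ∘ trans (sym (cong (fromMaybe 0) eq)))
      (≤-trans (≤-trans (value-≤-extend r (suc j) r≤k) ≥r) (≤-reflexive (sym (cong (fromMaybe 0) eq))))))

  extend-first : ∀ r {k a} → length r ≤ k → extend i r k at 0 ≡ just a →
    (0 < length r × r at 0 ≡ just a) ⊎ (length r ≡ 0 × 0 < k × a ≡ i)
  extend-first r {k} r≤k first with nth (extend i r k) 0 | extend-entry i r {k} 0 r≤k
  extend-first r r≤k refl | _ | old 0<l eq          = inj₁ (0<l , eq)
  extend-first r r≤k refl | _ | new (l≤0 , 0<k) _ = inj₂ (n≤0⇒n≡0 l≤0 , 0<k , refl)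

ψ-TripleRule : ∀ i → 0 < i → (X : Triangle n) → ConsecutiveRows CAPRows X →
               ∀ r s → r Fin.< s → TripleRule (lookup (ψ-rows i X) r) (lookup (ψ-rows i X) s)
ψ-TripleRule i i>0 []      _ ()
ψ-TripleRule i i>0 (u ∷ X) caps@(cap , caps′) r s r<s
  rewrite Vec.lookup-zipWith (extend i) r ([] ∷ ψ-rows (suc i) X) u
        | Vec.lookup-zipWith (extend i) s ([] ∷ ψ-rows (suc i) X) u =
  extend-TripleRule (lookup R r) (lookup R s) i>0 (above r) (above s) (ψ-bounds i u X caps r) (ψ-bounds i u X caps s)
    (λ c (s≤c , c<u) r≤c → Triple⇒disjoint u v r s (proj₂ cap r s r<s) c
      (≤-trans (≤-reflexive (sym (length≡ s))) s≤c , c<u) (≤-trans (≤-reflexive (sym (length≡ r))) r≤c))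
    (previous r s r<s)
  where
  v = row₁ X
  R = [] ∷ ψ-rows (suc i) X
  length≡ : ∀ r → length (lookup R r) ≡ lookup (0 ∷ v) r
  length≡ zero    = refl
  length≡ (suc r) = ψ-lengths (suc i) X caps′ r
  above : ∀ r → All (suc i ≤_) (lookup R r)
  above zero    = []
  above (suc r) = All.lookup (All.map proj₁ (ψ-Rows (suc i) X)) (∈-toList⁺ (∈-lookupᵛ r (ψ-rows (suc i) X)))
  previous : ∀ r s → r Fin.< s → TripleRule (lookup R r) (lookup R s)
  -- The row entering on top is still empty, so its value is the padding 0.
  previous zero    (suc s) _   = λ j ≢0 _ →
    ≤-trans (s≤s (≤-reflexive (cong (fromMaybe 0) (nth-[] j)))) (n≢0⇒n>0 ≢0)
  previous (suc r) (suc s) r<s = ψ-TripleRule (suc i) z<s X caps′ r s (s<s⁻¹ r<s)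

-- A row can receive its first box only at the stage where it enters on top; for row `r` this is
-- stage `i + toℕ r`.
ψ-first : ∀ i (X : Triangle n) → ConsecutiveRows CAPRows X → ∀ r {a} →
          lookup (ψ-rows i X) r at 0 ≡ just a → a ≡ i + toℕ r
ψ-first i (u ∷ X) caps@(cap , caps′) r eq
  rewrite Vec.lookup-zipWith (extend i) r ([] ∷ ψ-rows (suc i) X) u
  with r | extend-first (lookup ([] ∷ ψ-rows (suc i) X) r) (ψ-bounds i u X caps r) eq
... | zero  | inj₂ (_ , _ , refl) = sym (+-identityʳ i)
... | suc r | inj₁ (_ , eq′)      = trans (ψ-first (suc i) X caps′ r eq′) (sym (+-suc i (toℕ r)))
-- A lower row starting now would get a new box in column 0, which always lies in the closed range
-- of the top row.
... | suc r | inj₂ (l≡0 , 0<u , _) = contradiction z≤n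
  (Triple⇒disjoint u (row₁ X) zero (suc r) (proj₂ cap zero (suc r) z<s) 0
    (≤-reflexive (trans (sym (ψ-lengths (suc i) X caps′ r)) l≡0) , 0<u) z≤n)

column⁺ : ∀ (R : Vec (List ℕ) k) j r {a} → lookup R r at j ≡ just a → a ∈ column (toList R) j
column⁺ (x ∷ R) j zero    eq rewrite eq = here refl
column⁺ (x ∷ R) j (suc r) eq with x at j
... | nothing = column⁺ R j r eq
... | just _  = there (column⁺ R j r eq)

column⁻ : ∀ (R : Vec (List ℕ) k) j {a} → a ∈ column (toList R) j → ∃[ r ] lookup R r at j ≡ just a
column⁻ (x ∷ R) j a∈ with x at j in eq
column⁻ (x ∷ R) j a∈          | nothing with r , eq′ ← column⁻ R j a∈ = suc r , eq′
column⁻ (x ∷ R) j (here refl) | just _  = zero , eq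
column⁻ (x ∷ R) j (there a∈)  | just _  with r , eq′ ← column⁻ R j a∈ = suc r , eq′

ψ-tableau : ∀ {γ : Vec ℕ n} {X} → IsCAP γ X → IsCompositionTableauWithFirstColumn (γ ⁺) (𝓕 γ) (ψ X)
ψ-tableau {X = X} (refl , caps) = record
  { shape       = nonemptyRows-shape R (row₁ X) (ψ-lengths 1 X caps)
  ; positive    = All.filter⁺ _ (All.map proj₁ (ψ-Rows 1 X))
  ; firstColumn = AllPairs⇒Linked (subst (AllPairs _<_) (sym column₀) (AllPairs-mapMaybe (_at 0)
      (AllPairs-toList R first<)))
  ; rows        = All.filter⁺ _ (All.map (AllPairs⇒Linked ∘ proj₂) (ψ-Rows 1 X))
  ; triples     = λ r s j r<s → AllPairs-lookup {R = TripleRule}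
      (AllPairs.filter⁺ _ (AllPairs-toList R (ψ-TripleRule 1 z<s X caps))) r s r<s j
  } , subst (λ xs → (_∈ xs) ≐ 𝓕 (row₁ X)) (sym column₀) (to , from)
  where
  R = ψ-rows 1 X
  column₀ = column-dropEmpty (toList R) 0

  first< : ∀ r s → r Fin.< s → ∀ {a b} → lookup R r at 0 ≡ just a → lookup R s at 0 ≡ just b → a < b
  first< r s r<s p q rewrite ψ-first 1 X caps r p | ψ-first 1 X caps s q = s<s r<s

  to : ∀ {a} → a ∈ column (toList R) 0 → 𝓕 (row₁ X) a
  to a∈ with r , eq ← column⁻ R 0 a∈ =
    r , ψ-first 1 X caps r eq , <-≤-trans (nth⇒< (lookup R r) eq) (≤-reflexive (ψ-lengths 1 X caps r))

  from : ∀ {a} → 𝓕 (row₁ X) a → a ∈ column (toList R) 0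
  from (r , refl , u>0)
    with a , eq ← nth-< (lookup R r) {0} (<-≤-trans u>0 (≤-reflexive (sym (ψ-lengths 1 X caps r)))) =
    subst (_∈ column (toList R) 0) (ψ-first 1 X caps r eq) (column⁺ R 0 r eq)

φ-tableau : ∀ {μ : Vec ℕ n} {Y} → IsGT μ Y → IsReverseTableau (μ ⁺) (φ Y)
φ-tableau {Y = Y} (refl , gts) = record
  { shape    = nonemptyRows-shape R (row₁ Y) (φ-lengths 1 Y gts)
  ; positive = All.filter⁺ _ (All.map proj₁ (φ-Rows 1 Y))
  ; rows     = All.filter⁺ _ (All.map (AllPairs⇒Linked ∘ proj₂) (φ-Rows 1 Y))
  ; cols     = λ j → AllPairs⇒Linked (subst (AllPairs _>_) (sym (column-dropEmpty (toList R) j)) (φ-strict 1 Y gts j))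
  }
  where
  R = φ-rows 1 Y

-- Commutativity of the square.

⁺-descending : ∀ (μ : Vec ℕ n) → Descending (toList μ) → Descending (μ ⁺)
⁺-descending μ = AllPairs.filter⁺ (0 <?_)

GT-descending : (Y : Triangle n) → ConsecutiveRows GTRows Y → Descending (toList (row₁ Y))
GT-descending []      _        = []
GT-descending (u ∷ Y) (gt , _) = GTRows⇒descending u (row₁ Y) gt

φ∘Θ≡θ∘ψ : (X : Triangle n) → ConsecutiveRows CAPRows X → φ (Θ X) ≡ θ (ψ X)
φ∘Θ≡θ∘ψ X caps = sym (θ-unique (ψ X) (φ (Θ X))
  (subst Descending (sym (nonemptyRows-shape (φ-rows 1 (Θ X)) (row₁ (Θ X)) (φ-lengths 1 (Θ X) gts)))
    (⁺-descending (row₁ (Θ X)) (GT-descending (Θ X) gts)))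
  (All.all-filter _ (toList (φ-rows 1 (Θ X))))
  sorted-column)
  where
  gts = Θ-GT X caps
  sorted-column : ∀ j → sort↓ (column (ψ X) j) ≡ column (φ (Θ X)) j
  sorted-column j rewrite column-dropEmpty (toList (ψ-rows 1 X)) j | column-dropEmpty (toList (φ-rows 1 (Θ X))) j =
    descending-↭⇒≡ (sort↓-descending (column (toList (ψ-rows 1 X)) j)) (AllPairs.map <⇒≤ (φ-strict 1 (Θ X) gts j))
      (↭-trans (sort↓-↭ _) (columns-ψφ 1 X caps j))

-- Sorting the columns of a composition tableau

descending-nth : ∀ {r} → Descending r → ∀ {i j b} → i ≤ j → nth r j ≡ just b → ∃[ a ] nth r i ≡ just a × a ≥ b
descending-nth {x ∷ r} (x≥ ∷ _) {zero}  {zero}  _   refl = x , refl , ≤-refl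
descending-nth {x ∷ r} (x≥ ∷ _) {zero}  {suc j} _   eq   = x , refl , nth-All j x≥ eq
descending-nth {x ∷ r} (_ ∷ d)  {suc i} {suc j} i≤j eq   = descending-nth d (s≤s⁻¹ i≤j) eq
descending-nth {[]}    _        {_}     {zero}  _   ()
descending-nth {[]}    _        {_}     {suc j} _   ()

-- A row reaching column `j` also reaches column `i`, with an entry at least as large.
cnt-column : ∀ {U} → All Descending U → ∀ c {i j} → i ≤ j → cnt c (column U j) ≤ cnt c (column U i)
cnt-column []               c         i≤j = z≤n
cnt-column {r ∷ U} (d ∷ ds) c {i} {j} i≤j with nth r j in eq
... | just b with a , eq′ , b≤a ← descending-nth d i≤j eq rewrite eq′ =
  +-mono-≤ (exceeds-mono c b≤a) (cnt-column ds c i≤j)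
... | nothing with nth r i
...   | nothing = cnt-column ds c i≤j
...   | just a  = ≤-trans (cnt-column ds c i≤j) (m≤n+m _ (exceeds c a))

module _ {α : List ℕ} {U : Filling} (tableau : IsCompositionTableau α U) where
  open IsCompositionTableau tableau

  private
    descending-rows : All Descending U
    descending-rows = All.map (Linked⇒AllPairs ≥-trans) rows

  -- Equal entries in rows `r < s` meet the premise of `triples`, so they exceed the left neighbour
  -- in row `r`, although rows weakly decrease.
  column-distinct : ∀ j → AllPairs _≢_ (column U j)
  column-distinct zero    = AllPairs.map <⇒≢ (Linked⇒AllPairs <-trans firstColumn)
  column-distinct (suc j) = AllPairs-mapMaybe (_at suc j) (lookup-AllPairs U distinct)
    where
    distinct : ∀ r s → r Fin.< s → ∀ {a b} →
               List.lookup U r at suc j ≡ just a → List.lookup U s at suc j ≡ just b → a ≢ b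
    distinct r s r<s {a} p q refl
      with a′ , p′ , a≤a′ ← descending-nth (All.lookup descending-rows (∈-lookup r)) (n≤1+n j) p
      with rule ← triples r s j r<s
      rewrite p | q | p′ =
      <-irrefl refl (≤-trans (rule (n>0⇒n≢0 (nth-All (suc j) (All.lookup positive (∈-lookup s)) q)) ≤-refl) a≤a′)

  sorted-column-strict : ∀ j → AllPairs _>_ (sort↓ (column U j))
  sorted-column-strict j = AllPairs.zipWith (λ (x≥y , x≢y) → ≤∧≢⇒< x≥y (x≢y ∘ sym))
    (sort↓-descending (column U j) ,
     PermSetoid.AllPairs-resp-↭ (setoid ℕ) (_∘ sym) (resp₂ _≢_)
       (↭⇒↭ₛ (↭-sym (sort↓-↭ (column U j)))) (column-distinct j))

  θ-rows : All (Linked _≥_) (θ U)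
  θ-rows = columns-All (map sort↓ (columns U)) λ k _ → AllPairs⇒Linked (AllPairs-mapMaybe (_at k)
    (AllPairs.map⁺ (AllPairs.applyUpTo⁺₁ (column U) (width U) λ i<j _ → dominates k i<j)))
    where
    dominates : ∀ k {i j} → i < j → ∀ {a b} →
                -- If `a < b`, more than `k` entries of column `j` exceed `a`, hence more than `k`
                -- entries of column `i` do, and `a` would exceed itself.
                sort↓ (column U i) at k ≡ just a → sort↓ (column U j) at k ≡ just b → a ≥ b
    dominates k {i} {j} i<j {a} {b} p q = ≮⇒≥ λ a<b → <-irrefl refl
      (<cnt⇒at (sort↓-descending (column U i)) k {c = a} p (begin-strict
        k                             <⟨ at⇒<cnt (sort↓-descending (column U j)) k q a<b ⟩
        cnt a (sort↓ (column U j))    ≡⟨ cnt-↭ a (sort↓-↭ (column U j)) ⟩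
        cnt a (column U j)            ≤⟨ cnt-column descending-rows a (<⇒≤ i<j) ⟩
        cnt a (column U i)            ≡⟨ cnt-↭ a (sort↓-↭ (column U i)) ⟨
        cnt a (sort↓ (column U i))    ∎))
      where open ≤-Reasoning

  θ-positive : All (All (0 <_)) (θ U)
  θ-positive = columns-All (map sort↓ (columns U)) λ k _ → All-column k
    (All.map⁺ (columns-All U λ j _ → All-resp-↭ (↭-sym (sort↓-↭ (column U j))) (All-column j positive)))

  cnt-θ : ∀ c → cnt c (lengths (θ U)) ≡ cnt c α
  cnt-θ c = begin
    cnt c (lengths (θ U))         ≡⟨ length-column (θ U) c ⟨
    length (column (θ U) c)       ≡⟨ cong length (column-θ U c) ⟩
    length (sort↓ (column U c))   ≡⟨ ↭-length (sort↓-↭ (column U c)) ⟩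
    length (column U c)           ≡⟨ length-column U c ⟩
    cnt c (lengths U)             ≡⟨ cong (cnt c) shape ⟩
    cnt c α                       ∎
    where open ≡-Reasoning

-- For positive parts the count at threshold 0 is the number of parts.
positive-descending-unique : ∀ {xs ys} → Descending xs → Descending ys → All (0 <_) xs → All (0 <_) ys →
                             (∀ c → cnt c xs ≡ cnt c ys) → xs ≡ ys
positive-descending-unique d e xs>0 ys>0 eq =
  descending-unique d e (trans (sym (cnt-all xs>0)) (trans (eq 0) (cnt-all ys>0))) eq

θ-tableau : ∀ (γ : Vec ℕ n) {U} → IsCompositionTableau (γ ⁺) U → IsReverseTableau (γ ~ ⁺) (θ U)
θ-tableau γ {U} tableau = record
  { shape    = positive-descending-unique (columns-descending S) (⁺-descending (γ ~) (~-descending γ))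
                 (All.map⁺ (columns-All S λ k → <width⇒column S)) (All.all-filter (0 <?_) (toList (γ ~))) λ c → begin
                   cnt c (lengths (θ U))   ≡⟨ cnt-θ tableau c ⟩
                   cnt c (γ ⁺)             ≡⟨ cnt-positive c (toList γ) ⟩
                   cnt c (toList γ)        ≡⟨ cnt-↭ c (~-↭ γ) ⟨
                   cnt c (toList (γ ~))    ≡⟨ cnt-positive c (toList (γ ~)) ⟨
                   cnt c (γ ~ ⁺)           ∎
  ; positive = θ-positive tableau
  ; rows     = θ-rows tableau
  ; cols     = λ j → AllPairs⇒Linked (subst (AllPairs _>_) (sym (column-θ U j)) (sorted-column-strict tableau j))
  }
  where
  open ≡-Reasoning
  S = map sort↓ (columns U)

theorem3p3p5 : ∀ (n : ℕ) (γ : Vec ℕ n) →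
    Inverses (IsCAPSortingTo (γ ~)) (IsGT (γ ~)) Θ Θ̃
    × CommutingSquare
    (IsCAP γ)
    (IsGT (γ ~))
    (IsCompositionTableauWithFirstColumn (γ ⁺) (𝓕 γ))
    (IsReverseTableau (γ ~ ⁺))
    Θ ψ φ θ
theorem3p3p5 n γ = Θ-inverses (γ ~) , record
  { top      = λ { {X} (refl , caps) → row₁-Θ X , Θ-GT X caps }
  ; left     = ψ-tableau
  ; right    = φ-tableau
  ; bottom   = θ-tableau γ ∘ proj₁
  ; commutes = λ { {X} (_ , caps) → φ∘Θ≡θ∘ψ X caps }
  }
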